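{- Let $F$ be a field of characteristic $0$ and let $n$ be an odd positive integer. Let $s_n=n\times\langle1\rangle$ be the sum-of-squares form $x_1^2+\dots+x_n^2$ on $F^n$. Then $$\omega(\mathcal G_{s_n,1})=\begin{cases}n-1,&\text{if }n\notin D_F(\langle1,2(n-1)\rangle),\\ n,&\text{if }n\in D_F(\langle1,2(n-1)\rangle)\text{ and }2(n+1)\notin F^{\ast2},\\ n+1,&\text{if }n\in D_F(\langle1,2(n-1)\rangle)\text{ and }2(n+1)\in F^{\ast2}.\end{cases}$$
   Context: For a quadratic form $q$ on an $F$-vector space $V$ and $a\in F$, $\mathcal G_{q,a}$ is the graph with vertex set $V$ and edge set $\{\{x,y\}\mid x\ne y,\ q(x-y)=a\}$; $\omega$ denotes the clique number (size of a largest clique). $\langle a_1,\dots,a_m\rangle$ denotes the diagonal form $\sum a_ix_i^2$, $D_F(\varphi)$ is the set of nonzero elements of $F$ represented by $\varphi$, and $F^{\ast2}$ is the set of nonzero squares in $F$. -}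

module Defs where

open import Level using (_⊔_; suc)
open import Algebra.Bundles using (CommutativeRing)
open import Algebra.Module.Bundles using (LeftModule)
open import Data.Fin.Base using (Fin)
open import Data.Nat.Base as ℕ using (ℕ)
open import Data.Product.Base using (_,_; _×_; ∃-syntax)
open import Data.Vec.Functional using (Vector; zipWith; map; replicate; []; _∷_)
open import Relation.Binary.Bundles using (Setoid)
open import Relation.Binary.Core using (Rel)
open import Relation.Binary.Definitions using (Symmetric; Irreflexive; _Respects₂_)
open import Relation.Binary.PropositionalEquality.Core using (_≢_)
open import Relation.Nullary.Negation using (¬_)
import Algebra.Definitions
import Algebra.Module.Properties.LeftModule as LeftModuleProperties
import Algebra.Properties.AbelianGroup as AbelianGroupProperties
import Algebra.Properties.Ring as RingProperties
import Algebra.Properties.Semiring.Mult as SemiringMult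
import Algebra.Properties.Semiring.Sum as SemiringSum
import Algebra.Solver.Ring.NaturalCoefficients.Default as SemiringSolver
import Data.Vec.Functional.Relation.Binary.Equality.Setoid as VectorEquality
import Relation.Binary.Reasoning.Setoid as SetoidReasoning

-- Equality is not assumed decidable and there is no primitive apartness:
-- read classically, these are exactly the fields.
record Field c ℓ : Set (suc (c ⊔ ℓ)) where
  field
    commutativeRing : CommutativeRing c ℓ

  open CommutativeRing commutativeRing public
  open Algebra.Definitions _≈_ using (Invertible)

  field
    0≉1        : 0# ≉ 1#
    invertible : ∀ {x} → x ≉ 0# → Invertible 1# _*_ x

record Graph v ℓ₁ ℓ₂ : Set (suc (v ⊔ ℓ₁ ⊔ ℓ₂)) where
  field
    vertices : Setoid v ℓ₁

  open Setoid vertices renaming (Carrier to Vertex) using (_≈_) public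

  field
    Adj        : Rel Vertex ℓ₂
    Adj-resp   : Adj Respects₂ _≈_
    Adj-sym    : Symmetric Adj
    Adj-irrefl : Irreflexive _≈_ Adj

module _ {v ℓ₁ ℓ₂} (G : Graph v ℓ₁ ℓ₂) where
  open Graph G

  -- A clique of size k is enumerated by k vertices.  They are distinct since
  -- adjacency is irreflexive.
  IsClique : ∀ {k} → Vector Vertex k → Set ℓ₂
  IsClique x = ∀ {i j} → i ≢ j → Adj (x i) (x j)

  HasClique : ℕ → Set (v ⊔ ℓ₂)
  HasClique k = ∃[ x ] IsClique {k} x

  -- ω(G) = k.  Cliques of every size are compared with k, so an infinite clique
  -- (which contains finite ones of all sizes) is excluded too.
  CliqueNumber : ℕ → Set (v ⊔ ℓ₂)
  CliqueNumber k = HasClique k × (∀ m → HasClique m → m ℕ.≤ k)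

module OverField {c ℓ} (F : Field c ℓ) where
  open Field F
  open SemiringMult semiring using () renaming (_×_ to _×ₙ_)
  open SemiringSum semiring using (sum; sum-syntax; sum-cong-≋; ∑-distrib-+; *-distribˡ-sum)
  open SemiringSolver commutativeSemiring using (solve; _:=_; _:+_; _:*_)
  open SetoidReasoning setoid

  VectorSpace : ∀ m ℓm → Set (c ⊔ ℓ ⊔ suc (m ⊔ ℓm))
  VectorSpace = LeftModule ring

  ⌜_⌝ : ℕ → Carrier
  ⌜ n ⌝ = n ×ₙ 1#

  CharacteristicZero : Set ℓ
  CharacteristicZero = ∀ n → ⌜ ℕ.suc n ⌝ ≉ 0#

  F*² : Carrier → Set (c ⊔ ℓ)
  F*² a = a ≉ 0# × ∃[ y ] a ≈ y * y

  module _ {m ℓm} (V : VectorSpace m ℓm) where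
    open LeftModule V

    record QuadraticForm : Set (c ⊔ ℓ ⊔ m ⊔ ℓm) where
      field
        form : Carrierᴹ → Carrier

      polar : Carrierᴹ → Carrierᴹ → Carrier
      polar x y = form (x +ᴹ y) - form x - form y

      -- Linearity in the second argument follows, as polar is symmetric.
      field
        form-cong : ∀ {x y} → x ≈ᴹ y → form x ≈ form y
        form-*ₗ   : ∀ a x → form (a *ₗ x) ≈ (a * a) * form x
        polar-+ᴹ  : ∀ x y z → polar (x +ᴹ y) z ≈ polar x z + polar y z
        polar-*ₗ  : ∀ a x y → polar (a *ₗ x) y ≈ a * polar x y

  module _ {m ℓm} {V : VectorSpace m ℓm} (q : QuadraticForm V) where
    open LeftModule V
    open QuadraticForm q

    D : Carrier → Set (ℓ ⊔ m)
    D a = a ≉ 0# × ∃[ x ] form x ≈ a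

    private
      open LeftModuleProperties V using (inverseˡ-uniqueᴹ)
      module +ᴹ = AbelianGroupProperties +ᴹ-abelianGroup
      module R = RingProperties ring

      -1*ₗx≈-x : ∀ x → (- 1#) *ₗ x ≈ᴹ -ᴹ x
      -1*ₗx≈-x x = inverseˡ-uniqueᴹ _ x
        (≈ᴹ-trans (+ᴹ-congˡ (≈ᴹ-sym (*ₗ-identityˡ x)))
        (≈ᴹ-trans (≈ᴹ-sym (*ₗ-distribʳ x (- 1#) 1#))
        (≈ᴹ-trans (*ₗ-congʳ (-‿inverseˡ 1#)) (*ₗ-zeroˡ x))))

      form-neg : ∀ x → form (-ᴹ x) ≈ form x
      form-neg x = begin
        form (-ᴹ x)                  ≈⟨ form-cong (-1*ₗx≈-x x) ⟨
        form ((- 1#) *ₗ x)           ≈⟨ form-*ₗ (- 1#) x ⟩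
        ((- 1#) * (- 1#)) * form x   ≈⟨ *-congʳ (R.-1*x≈-x (- 1#)) ⟩
        (- (- 1#)) * form x          ≈⟨ *-congʳ (R.-‿involutive 1#) ⟩
        1# * form x                  ≈⟨ *-identityˡ (form x) ⟩
        form x                       ∎

      form-swap : ∀ x y → form (x +ᴹ -ᴹ y) ≈ form (y +ᴹ -ᴹ x)
      form-swap x y = trans (sym (form-neg (x +ᴹ -ᴹ y)))
        (form-cong (+ᴹ.⁻¹-anti-homo‿- x y))

    𝒢 : Carrier → Graph m ℓm (ℓ ⊔ ℓm)
    𝒢 a = record
      { vertices   = ≈ᴹ-setoid
      ; Adj        = λ x y → x ≉ᴹ y × form (x +ᴹ -ᴹ y) ≈ a
      ; Adj-resp   =
          (λ y≈z (x≉y , q≈a) →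
            (λ x≈z → x≉y (≈ᴹ-trans x≈z (≈ᴹ-sym y≈z))) ,
            trans (form-cong (+ᴹ-congˡ (-ᴹ‿cong (≈ᴹ-sym y≈z)))) q≈a) ,
          (λ y≈z (y≉x , q≈a) →
            (λ z≈x → y≉x (≈ᴹ-trans y≈z z≈x)) ,
            trans (form-cong (+ᴹ-congʳ (≈ᴹ-sym y≈z))) q≈a)
      ; Adj-sym    = λ {x} {y} (x≉y , q≈a) →
          (λ y≈x → x≉y (≈ᴹ-sym y≈x)) , trans (form-swap y x) q≈a
      ; Adj-irrefl = λ x≈y (x≉y , _) → x≉y x≈y
      }

  module _ (n : ℕ) where
    open VectorEquality setoid using (≋-isEquivalence)

    F^ : VectorSpace c ℓ
    F^ = record
      { Carrierᴹ     = Vector Carrier n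
      ; _≈ᴹ_         = λ x y → ∀ i → x i ≈ y i
      ; _+ᴹ_         = zipWith _+_
      ; _*ₗ_         = λ a → map (a *_)
      ; 0ᴹ           = replicate n 0#
      ; -ᴹ_          = map (λ a → - a)
      ; isLeftModule = record
        { isLeftSemimodule = record
          { +ᴹ-isCommutativeMonoid = record
            { isMonoid = record
              { isSemigroup = record
                { isMagma = record
                  { isEquivalence = ≋-isEquivalence n
                  ; ∙-cong        = λ x≈y u≈v i → +-cong (x≈y i) (u≈v i)
                  }
                ; assoc = λ x y z i → +-assoc (x i) (y i) (z i)
                }
              ; identity = (λ x i → +-identityˡ (x i)) , (λ x i → +-identityʳ (x i))
              }
            ; comm = λ x y i → +-comm (x i) (y i)
            }
          ; isPreleftSemimodule = record
            { *ₗ-cong      = λ a≈b x≈y i → *-cong a≈b (x≈y i)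
            ; *ₗ-zeroˡ     = λ x i → zeroˡ (x i)
            ; *ₗ-distribʳ  = λ x a b i → distribʳ (x i) a b
            ; *ₗ-identityˡ = λ x i → *-identityˡ (x i)
            ; *ₗ-assoc     = λ a b x i → *-assoc a b (x i)
            ; *ₗ-zeroʳ     = λ a i → zeroʳ a
            ; *ₗ-distribˡ  = λ a x y i → distribˡ a (x i) (y i)
            }
          }
        ; -ᴹ‿cong    = λ x≈y i → -‿cong (x≈y i)
        ; -ᴹ‿inverse = (λ x i → -‿inverseˡ (x i)) , (λ x i → -‿inverseʳ (x i))
        }
      }

  module _ {n : ℕ} (a : Vector Carrier n) where
    open LeftModule (F^ n)

    private
      q : Vector Carrier n → Carrier
      q x = ∑[ i < n ] (a i * (x i * x i))

      b : Vector Carrier n → Vector Carrier n → Carrier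
      b x y = ∑[ i < n ] (a i * (x i * y i + y i * x i))

      q-+ : ∀ x y → q (x +ᴹ y) ≈ (q x + q y) + b x y
      q-+ x y = trans (sum-cong-≋ (λ i → expand (a i) (x i) (y i)))
        (trans (∑-distrib-+ (λ i → a i * (x i * x i) + a i * (y i * y i)) _)
        (+-congʳ (∑-distrib-+ (λ i → a i * (x i * x i)) _)))
        where
        expand : ∀ a x y → a * ((x + y) * (x + y)) ≈
                 (a * (x * x) + a * (y * y)) + a * (x * y + y * x)
        expand = solve 3 (λ a x y → a :* ((x :+ y) :* (x :+ y)) :=
                 (a :* (x :* x) :+ a :* (y :* y)) :+ a :* (x :* y :+ y :* x)) refl

      polar≈b : ∀ x y → q (x +ᴹ y) - q x - q y ≈ b x y
      polar≈b x y = begin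
        q (x +ᴹ y) - q x - q y                 ≈⟨ +-assoc _ _ _ ⟩
        q (x +ᴹ y) + (- q x - q y)             ≈⟨ +-cong (q-+ x y) (-‿+-comm (q x) (q y)) ⟩
        (q x + q y) + b x y - (q x + q y)      ≈⟨ xyx⁻¹≈y (q x + q y) (b x y) ⟩
        b x y                                  ∎
        where
        open RingProperties ring using (-‿+-comm)
        open AbelianGroupProperties +-abelianGroup using (xyx⁻¹≈y)

      b-+ : ∀ x y z → b (x +ᴹ y) z ≈ b x z + b y z
      b-+ x y z = trans (sum-cong-≋ (λ i → expand (a i) (x i) (y i) (z i)))
        (∑-distrib-+ (λ i → a i * (x i * z i + z i * x i)) _)
        where
        expand : ∀ a x y z → a * ((x + y) * z + z * (x + y)) ≈
                 a * (x * z + z * x) + a * (y * z + z * y)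
        expand = solve 4 (λ a x y z → a :* ((x :+ y) :* z :+ z :* (x :+ y)) :=
                 a :* (x :* z :+ z :* x) :+ a :* (y :* z :+ z :* y)) refl

      b-* : ∀ e x y → b (e *ₗ x) y ≈ e * b x y
      b-* e x y = trans (sum-cong-≋ (λ i → expand (a i) e (x i) (y i)))
        (sym (*-distribˡ-sum e (λ i → a i * (x i * y i + y i * x i))))
        where
        expand : ∀ a e x y → a * ((e * x) * y + y * (e * x)) ≈ e * (a * (x * y + y * x))
        expand = solve 4 (λ a e x y → a :* ((e :* x) :* y :+ y :* (e :* x)) :=
                 e :* (a :* (x :* y :+ y :* x))) refl

      q-* : ∀ e x → q (e *ₗ x) ≈ (e * e) * q x
      q-* e x = trans (sum-cong-≋ (λ i → expand (a i) e (x i)))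
        (sym (*-distribˡ-sum (e * e) (λ i → a i * (x i * x i))))
        where
        expand : ∀ a e x → a * ((e * x) * (e * x)) ≈ (e * e) * (a * (x * x))
        expand = solve 3 (λ a e x → a :* ((e :* x) :* (e :* x)) :=
                 (e :* e) :* (a :* (x :* x))) refl

    ⟪_⟫ : QuadraticForm (F^ n)
    ⟪_⟫ = record
      { form      = λ x → ∑[ i < n ] (a i * (x i * x i))
      ; form-cong = λ x≈y → sum-cong-≋ (λ i → *-congˡ (*-cong (x≈y i) (x≈y i)))
      ; form-*ₗ   = q-*
      ; polar-+ᴹ  = λ x y z → trans (polar≈b (x +ᴹ y) z)
          (trans (b-+ x y z) (sym (+-cong (polar≈b x z) (polar≈b y z))))
      ; polar-*ₗ  = λ e x y → trans (polar≈b (e *ₗ x) y)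
          (trans (b-* e x y) (sym (*-congˡ (polar≈b x y))))
      }

  s : ∀ n → QuadraticForm (F^ n)
  s n = ⟪ replicate n 1# ⟫

  ⟪1,_⟫ : Carrier → QuadraticForm (F^ 2)
  ⟪1, a ⟫ = ⟪ 1# ∷ a ∷ [] ⟫

{-# OPTIONS --safe #-}

-- As 2(x² + y²) = (x + y)² + (x - y)² and n is odd, 2 s_n is isometric to
-- B = N⟨1⟩ ⊥ ⟨2⟩ with N = n - 1, and cliques of the graph become sets of points at mutual
-- B-distance 2.  The standard basis e of N⟨1⟩ is such a set.  As in Witt's extension
-- theorem, reflections carry any N points at mutual distance 2 to e; the reflections
-- depend on whether some distances vanish, which is harmless since the upper bounds on ω
-- are negative statements.  A point at distance 2 from all of e has equal coordinates a
-- along e and a coordinate t along ⟨2⟩; with X = N a - 1 such points correspond to vectors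
-- (X , t) of norm n in the plane ⟨1, 2N⟩, and two of them are at distance 2 exactly when
-- their inner product there is 1.  So for N > 0 cliques of size N + r amount to r plane vectors
-- with Gram matrix N I + J.  One such vector says that n ∈ D⟨1, 2N⟩; by comparing
-- determinants a second one exists exactly when 2(n + 1) is also a square; three are
-- impossible in a plane.  The case n = 1 is done by hand.
module Submission where

open import Defs
open import Algebra.Solver.Ring.AlmostCommutativeRing
  using (AlmostCommutativeRing; fromCommutativeRing; _-Raw-AlmostCommutative⟶_)
open import Data.Empty using (⊥-elim)
open import Data.Fin.Base as Fin using (Fin; zero; suc; toℕ; _↑ˡ_; _↑ʳ_)
open import Data.Maybe.Base using (just; nothing)
open import Data.Nat.Base as ℕ using (ℕ)
open import Data.Nat.DivMod using (_/_; _%_; m≡m%n+[m/n]*n; m%n<n)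
open import Data.Nat.Divisibility using (_∤_; m%n≡0⇒n∣m)
open import Data.Product.Base using (_×_; _,_; proj₁; proj₂; ∃-syntax)
open import Data.Sum.Base using (_⊎_; inj₁; inj₂; [_,_]′)
open import Data.Vec.Functional using (Vector; _∷_; []; tail; replicate)
open import Function.Base using (_∘_; case_of_)
open import Level using (_⊔_)
open import Relation.Binary.Consequences using (dec⇒weaklyDec)
open import Relation.Binary.Definitions using (WeaklyDecidable)
open import Relation.Binary.PropositionalEquality as ≡ using (_≡_; _≢_)
open import Relation.Nullary.Decidable using (yes; no; ¬¬-excluded-middle)
open import Relation.Nullary.Negation using (¬_)
import Algebra.Properties.AbelianGroup
import Algebra.Properties.Ring
import Algebra.Properties.Semiring.Mult
import Algebra.Properties.Semiring.Sum
import Algebra.Solver.Ring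
import Data.Fin.Properties as Finₚ
import Data.Integer.Base as ℤ
import Data.Integer.Properties as ℤₚ
import Data.Nat.Properties as ℕₚ
import Data.Sign.Base as Sign
import Relation.Binary.Reasoning.Setoid

↑ʳ≢↑ˡ : ∀ {m n} (i : Fin m) (j : Fin n) → m ↑ʳ j ≢ i ↑ˡ n
↑ʳ≢↑ˡ {m} {n} i j eq = case ≡.trans (≡.sym (Finₚ.splitAt-↑ʳ m n j))
  (≡.trans (≡.cong (Fin.splitAt m) eq) (Finₚ.splitAt-↑ˡ m i n)) of λ ()

module OverAField {c ℓ} (F : Field c ℓ) where
  open Field F hiding (zero)
  open OverField F
  open Relation.Binary.Reasoning.Setoid setoid
  open Algebra.Properties.Semiring.Mult semiring using (×-homo-+; ×1-homo-*; ×-assoc-*)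
    renaming (_×_ to _×ₙ_)
  open Algebra.Properties.Semiring.Sum semiring
    using (sum; sum-cong-≋; ∑-distrib-+; *-distribˡ-sum; sum-replicate)
  open Algebra.Properties.AbelianGroup +-abelianGroup
    using (⁻¹-∙-comm; ⁻¹-involutive; ε⁻¹≈ε; x∙y⁻¹≈ε⇒x≈y; x≈y⇒x∙y⁻¹≈ε)
  open Algebra.Properties.Ring ring using (-‿distribˡ-*; -‿distribʳ-*)

  -- Ring solver with integer coefficients.

  module IntegerSolver where
    -- 0 and 1 are evaluated separately so that they denote 0# and 1# on the nose.
    ⟦_⟧ : ℤ.ℤ → Carrier
    ⟦ ℤ.+ 0 ⟧        = 0#
    ⟦ ℤ.+ 1 ⟧        = 1#
    ⟦ ℤ.+ (ℕ.2+ n) ⟧ = ⌜ ℕ.2+ n ⌝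
    ⟦ ℤ.-[1+ n ] ⟧   = - ⌜ ℕ.suc n ⌝

    ⟦+⟧ : ∀ n → ⟦ ℤ.+ n ⟧ ≈ ⌜ n ⌝
    ⟦+⟧ 0        = refl
    ⟦+⟧ 1        = sym (+-identityʳ 1#)
    ⟦+⟧ (ℕ.2+ n) = refl

    ⟦⟧-neg : ∀ i → ⟦ ℤ.- i ⟧ ≈ - ⟦ i ⟧
    ⟦⟧-neg (ℤ.+ 0)        = sym ε⁻¹≈ε
    ⟦⟧-neg (ℤ.+ 1)        = -‿cong (+-identityʳ 1#)
    ⟦⟧-neg (ℤ.+ (ℕ.2+ n)) = refl
    ⟦⟧-neg ℤ.-[1+ n ]     = trans (⟦+⟧ (ℕ.suc n)) (sym (⁻¹-involutive _))

    cancel : ∀ a b → (1# + a) - (1# + b) ≈ a - b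
    cancel a b = begin
      (1# + a) - (1# + b)      ≈⟨ +-cong (+-comm 1# a) (sym (⁻¹-∙-comm 1# b)) ⟩
      (a + 1#) + (- 1# - b)    ≈⟨ +-assoc a 1# _ ⟩
      a + (1# + (- 1# - b))    ≈⟨ +-congˡ (+-assoc 1# (- 1#) (- b)) ⟨
      a + ((1# - 1#) - b)      ≈⟨ +-congˡ (+-congʳ (-‿inverseʳ 1#)) ⟩
      a + (0# - b)             ≈⟨ +-congˡ (+-identityˡ _) ⟩
      a - b                    ∎

    ⟦⟧-⊖ : ∀ m n → ⟦ m ℤ.⊖ n ⟧ ≈ ⌜ m ⌝ - ⌜ n ⌝
    ⟦⟧-⊖ m ℕ.zero            = trans (⟦+⟧ m) (sym (trans (+-congˡ ε⁻¹≈ε) (+-identityʳ _)))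
    ⟦⟧-⊖ ℕ.zero (ℕ.suc n)    = sym (+-identityˡ _)
    ⟦⟧-⊖ (ℕ.suc m) (ℕ.suc n) = begin
      ⟦ ℕ.suc m ℤ.⊖ ℕ.suc n ⟧    ≡⟨ ≡.cong ⟦_⟧ (ℤₚ.[1+m]⊖[1+n]≡m⊖n m n) ⟩
      ⟦ m ℤ.⊖ n ⟧                ≈⟨ ⟦⟧-⊖ m n ⟩
      ⌜ m ⌝ - ⌜ n ⌝              ≈⟨ cancel ⌜ m ⌝ ⌜ n ⌝ ⟨
      ⌜ ℕ.suc m ⌝ - ⌜ ℕ.suc n ⌝  ∎

    ⟦⟧-+ : ∀ i j → ⟦ i ℤ.+ j ⟧ ≈ ⟦ i ⟧ + ⟦ j ⟧
    ⟦⟧-+ ℤ.-[1+ m ] ℤ.-[1+ n ] = begin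
      - ⌜ ℕ.suc (ℕ.suc (m ℕ.+ n)) ⌝  ≡⟨ ≡.cong (λ k → - ⌜ ℕ.suc k ⌝) (ℕₚ.+-suc m n) ⟨
      - ⌜ ℕ.suc m ℕ.+ ℕ.suc n ⌝      ≈⟨ -‿cong (×-homo-+ 1# (ℕ.suc m) (ℕ.suc n)) ⟩
      - (⌜ ℕ.suc m ⌝ + ⌜ ℕ.suc n ⌝)  ≈⟨ ⁻¹-∙-comm _ _ ⟨
      - ⌜ ℕ.suc m ⌝ - ⌜ ℕ.suc n ⌝    ∎
    ⟦⟧-+ ℤ.-[1+ m ] (ℤ.+ n)    =
      trans (⟦⟧-⊖ n (ℕ.suc m)) (trans (+-comm _ _) (+-congˡ (sym (⟦+⟧ n))))
    ⟦⟧-+ (ℤ.+ m)    ℤ.-[1+ n ] = trans (⟦⟧-⊖ m (ℕ.suc n)) (+-congʳ (sym (⟦+⟧ m)))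
    ⟦⟧-+ (ℤ.+ m)    (ℤ.+ n)    =
      trans (⟦+⟧ (m ℕ.+ n)) (trans (×-homo-+ 1# m n) (sym (+-cong (⟦+⟧ m) (⟦+⟧ n))))

    ⟦+◃⟧ : ∀ m n → ⟦ Sign.+ ℤ.◃ (m ℕ.* n) ⟧ ≈ ⌜ m ⌝ * ⌜ n ⌝
    ⟦+◃⟧ m n = begin
      ⟦ Sign.+ ℤ.◃ (m ℕ.* n) ⟧  ≡⟨ ≡.cong ⟦_⟧ (ℤₚ.+◃n≡+n (m ℕ.* n)) ⟩
      ⟦ ℤ.+ (m ℕ.* n) ⟧         ≈⟨ ⟦+⟧ (m ℕ.* n) ⟩
      ⌜ m ℕ.* n ⌝               ≈⟨ ×1-homo-* m n ⟩
      ⌜ m ⌝ * ⌜ n ⌝             ∎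

    ⟦-◃⟧ : ∀ m n → ⟦ Sign.- ℤ.◃ (m ℕ.* n) ⟧ ≈ - (⌜ m ⌝ * ⌜ n ⌝)
    ⟦-◃⟧ m n = begin
      ⟦ Sign.- ℤ.◃ (m ℕ.* n) ⟧  ≡⟨ ≡.cong ⟦_⟧ (ℤₚ.-◃n≡-n (m ℕ.* n)) ⟩
      ⟦ ℤ.- ℤ.+ (m ℕ.* n) ⟧     ≈⟨ ⟦⟧-neg (ℤ.+ (m ℕ.* n)) ⟩
      - ⟦ ℤ.+ (m ℕ.* n) ⟧       ≈⟨ -‿cong (trans (⟦+⟧ (m ℕ.* n)) (×1-homo-* m n)) ⟩
      - (⌜ m ⌝ * ⌜ n ⌝)         ∎

    ⟦⟧-* : ∀ i j → ⟦ i ℤ.* j ⟧ ≈ ⟦ i ⟧ * ⟦ j ⟧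
    ⟦⟧-* (ℤ.+ m)    (ℤ.+ n)    = trans (⟦+◃⟧ m n) (sym (*-cong (⟦+⟧ m) (⟦+⟧ n)))
    ⟦⟧-* (ℤ.+ m)    ℤ.-[1+ n ] = trans (⟦-◃⟧ m (ℕ.suc n))
      (trans (-‿distribʳ-* _ _) (*-congʳ (sym (⟦+⟧ m))))
    ⟦⟧-* ℤ.-[1+ m ] (ℤ.+ n)    = trans (⟦-◃⟧ (ℕ.suc m) n)
      (trans (-‿distribˡ-* _ _) (*-congˡ (sym (⟦+⟧ n))))
    ⟦⟧-* ℤ.-[1+ m ] ℤ.-[1+ n ] = begin
      ⟦ Sign.+ ℤ.◃ (ℕ.suc m ℕ.* ℕ.suc n) ⟧  ≈⟨ ⟦+◃⟧ (ℕ.suc m) (ℕ.suc n) ⟩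
      ⌜ ℕ.suc m ⌝ * ⌜ ℕ.suc n ⌝             ≈⟨ ⁻¹-involutive _ ⟨
      - - (⌜ ℕ.suc m ⌝ * ⌜ ℕ.suc n ⌝)       ≈⟨ -‿cong (-‿distribʳ-* _ _) ⟩
      - (⌜ ℕ.suc m ⌝ * - ⌜ ℕ.suc n ⌝)       ≈⟨ -‿distribˡ-* _ _ ⟩
      - ⌜ ℕ.suc m ⌝ * - ⌜ ℕ.suc n ⌝         ∎

    almostCommutativeRing : AlmostCommutativeRing c ℓ
    almostCommutativeRing = fromCommutativeRing commutativeRing

    ⟦⟧-homomorphism : ℤ.+-*-rawRing -Raw-AlmostCommutative⟶ almostCommutativeRing
    ⟦⟧-homomorphism = record
      { ⟦_⟧    = ⟦_⟧
      ; +-homo = ⟦⟧-+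
      ; *-homo = ⟦⟧-*
      ; -‿homo = ⟦⟧-neg
      ; 0-homo = refl
      ; 1-homo = refl
      }

    -- Equality in the field is not assumed decidable, so coefficients are compared as integers, and
    -- unequal integers give no verdict.
    _≟_ : WeaklyDecidable (λ i j → ⟦ i ⟧ ≈ ⟦ j ⟧)
    i ≟ j with dec⇒weaklyDec ℤₚ._≟_ i j
    ... | just ≡.refl = just refl
    ... | nothing     = nothing

    open Algebra.Solver.Ring ℤ.+-*-rawRing almostCommutativeRing ⟦⟧-homomorphism _≟_ public
      using (Polynomial; solve; con; _:=_; _:+_; _:*_; _:-_; :-_)

    ‵_ : ∀ {k} → ℕ → Polynomial k
    ‵ n = con (ℤ.+ n)

  open IntegerSolver

  -- An equation is derived from others by exhibiting the difference of its sides
  -- as a linear combination of theirs.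
  infix  1 _by_
  infixr 2 _&_
  infix  3 _·[_]

  _by_ : ∀ {x y z} → x - y ≈ z → z ≈ 0# → x ≈ y
  x-y≈z by z≈0 = x∙y⁻¹≈ε⇒x≈y _ _ (trans x-y≈z z≈0)

  _·[_] : ∀ a {x y} → x ≈ y → a * (x - y) ≈ 0#
  a ·[ x≈y ] = trans (*-congˡ (x≈y⇒x∙y⁻¹≈ε x≈y)) (zeroʳ a)

  _&_ : ∀ {x y} → x ≈ 0# → y ≈ 0# → x + y ≈ 0#
  x≈0 & y≈0 = trans (+-cong x≈0 y≈0) (+-identityˡ 0#)

  -- Vectors, diagonal bilinear forms and distances.

  infix 4 _≋_
  _≋_ : ∀ {n} → Vector Carrier n → Vector Carrier n → Set ℓ
  x ≋ y = ∀ i → x i ≈ y i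

  infixl 6 _⊝_ _⊕_·_
  _⊝_ : ∀ {n} → Vector Carrier n → Vector Carrier n → Vector Carrier n
  (x ⊝ y) i = x i - y i

  _⊕_·_ : ∀ {n} → Vector Carrier n → Carrier → Vector Carrier n → Vector Carrier n
  (x ⊕ a · y) i = x i + a * y i

  ⊝-≋-⊕ : ∀ {n} (x y : Vector Carrier n) → x ⊝ y ≋ x ⊕ - 1# · y
  ⊝-≋-⊕ x y i = solve 2 (λ x y → x :- y := x :+ (:- ‵ 1) :* y) refl (x i) (y i)

  module DiagonalForm {n} (w : Vector Carrier n) where
    B : Vector Carrier n → Vector Carrier n → Carrier
    B x y = sum (λ i → w i * (x i * y i))

    dist : Vector Carrier n → Vector Carrier n → Carrier
    dist x y = B (x ⊝ y) (x ⊝ y)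

    B-cong : ∀ {x x′ y y′} → x ≋ x′ → y ≋ y′ → B x y ≈ B x′ y′
    B-cong x≋x′ y≋y′ = sum-cong-≋ (λ i → *-congˡ (*-cong (x≋x′ i) (y≋y′ i)))

    B-comm : ∀ x y → B x y ≈ B y x
    B-comm x y = sum-cong-≋ (λ i → *-congˡ (*-comm (x i) (y i)))

    B-⊕ˡ : ∀ x a y z → B (x ⊕ a · y) z ≈ B x z + a * B y z
    B-⊕ˡ x a y z = begin
      B (x ⊕ a · y) z
        ≈⟨ sum-cong-≋ (λ i → expand (w i) (x i) (y i) (z i)) ⟩
      sum (λ i → w i * (x i * z i) + a * (w i * (y i * z i)))
        ≈⟨ ∑-distrib-+ (λ i → w i * (x i * z i)) _ ⟩
      B x z + sum (λ i → a * (w i * (y i * z i)))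
        ≈⟨ +-congˡ (*-distribˡ-sum a (λ i → w i * (y i * z i))) ⟨
      B x z + a * B y z ∎
      where
      expand : ∀ w x y z → w * ((x + a * y) * z) ≈ w * (x * z) + a * (w * (y * z))
      expand = solve 5 (λ a w x y z →
        w :* ((x :+ a :* y) :* z) := w :* (x :* z) :+ a :* (w :* (y :* z))) refl a

    B-⊕ʳ : ∀ x a y z → B z (x ⊕ a · y) ≈ B z x + a * B z y
    B-⊕ʳ x a y z = begin
      B z (x ⊕ a · y)    ≈⟨ B-comm z _ ⟩
      B (x ⊕ a · y) z    ≈⟨ B-⊕ˡ x a y z ⟩
      B x z + a * B y z  ≈⟨ +-cong (B-comm x z) (*-congˡ (B-comm y z)) ⟩
      B z x + a * B z y  ∎

    B-⊝ˡ : ∀ x y z → B (x ⊝ y) z ≈ B x z - B y z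
    B-⊝ˡ x y z = begin
      B (x ⊝ y) z           ≈⟨ B-cong (⊝-≋-⊕ x y) (λ _ → refl) ⟩
      B (x ⊕ - 1# · y) z    ≈⟨ B-⊕ˡ x (- 1#) y z ⟩
      B x z + - 1# * B y z  ≈⟨ solve 2 (λ a b → a :+ (:- ‵ 1) :* b := a :- b) refl (B x z) (B y z) ⟩
      B x z - B y z         ∎

    B-⊝ʳ : ∀ x y z → B z (x ⊝ y) ≈ B z x - B z y
    B-⊝ʳ x y z = trans (B-comm z _)
      (trans (B-⊝ˡ x y z) (+-cong (B-comm x z) (-‿cong (B-comm y z))))

    B-⊕-⊕ : ∀ x a y → B (x ⊕ a · y) (x ⊕ a · y) ≈ B x x + ⌜ 2 ⌝ * (a * B x y) + a * a * B y y
    B-⊕-⊕ x a y = begin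
      B (x ⊕ a · y) (x ⊕ a · y)
        ≈⟨ B-⊕ˡ x a y (x ⊕ a · y) ⟩
      B x (x ⊕ a · y) + a * B y (x ⊕ a · y)
        ≈⟨ +-cong (B-⊕ʳ x a y x) (*-congˡ (trans (B-⊕ʳ x a y y) (+-congʳ (B-comm y x)))) ⟩
      B x x + a * B x y + a * (B x y + a * B y y)
        ≈⟨ solve 4 (λ a xx xy yy → xx :+ a :* xy :+ a :* (xy :+ a :* yy) :=
             xx :+ ‵ 2 :* (a :* xy) :+ a :* a :* yy) refl a (B x x) (B x y) (B y y) ⟩
      B x x + ⌜ 2 ⌝ * (a * B x y) + a * a * B y y ∎

    dist-expand : ∀ x y → dist x y ≈ B x x - ⌜ 2 ⌝ * B x y + B y y
    dist-expand x y = begin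
      dist x y
        ≈⟨ B-⊝ˡ x y (x ⊝ y) ⟩
      B x (x ⊝ y) - B y (x ⊝ y)
        ≈⟨ +-cong (B-⊝ʳ x y x) (-‿cong (trans (B-⊝ʳ x y y) (+-congʳ (B-comm y x)))) ⟩
      B x x - B x y - (B x y - B y y)
        ≈⟨ solve 3 (λ xx xy yy → xx :- xy :- (xy :- yy) := xx :- ‵ 2 :* xy :+ yy) refl _ _ _ ⟩
      B x x - ⌜ 2 ⌝ * B x y + B y y ∎

    dist-cong : ∀ {x x′ y y′} → x ≋ x′ → y ≋ y′ → dist x y ≈ dist x′ y′
    dist-cong x≋x′ y≋y′ = B-cong x-y≋x′-y′ x-y≋x′-y′
      where x-y≋x′-y′ = λ i → +-cong (x≋x′ i) (-‿cong (y≋y′ i))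

    dist-sym : ∀ x y → dist x y ≈ dist y x
    dist-sym x y = sum-cong-≋ (λ i → solve 3 (λ w x y →
      w :* ((x :- y) :* (x :- y)) := w :* ((y :- x) :* (y :- x))) refl (w i) (x i) (y i))

    dist-self : ∀ {x y} → x ≋ y → dist x y ≈ 0#
    dist-self {x} {y} x≋y = begin
      dist x y                       ≈⟨ dist-cong x≋y (λ _ → refl) ⟩
      dist y y                       ≈⟨ dist-expand y y ⟩
      B y y - ⌜ 2 ⌝ * B y y + B y y  ≈⟨ solve 1 (λ b → b :- ‵ 2 :* b :+ b := ‵ 0) refl _ ⟩
      0#                             ∎

    -- Distance-preserving maps: translations and reflections.

    record Motion : Set (c ⊔ ℓ) where
      field
        move      : Vector Carrier n → Vector Carrier n
        move-cong : ∀ {x y} → x ≋ y → move x ≋ move y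
        move-dist : ∀ x y → dist (move x) (move y) ≈ dist x y

    open Motion

    _⨟_ : Motion → Motion → Motion
    σ ⨟ τ = record
      { move      = λ x → move τ (move σ x)
      ; move-cong = λ x≋y → move-cong τ (move-cong σ x≋y)
      ; move-dist = λ x y → trans (move-dist τ _ _) (move-dist σ x y)
      }

    translation : Vector Carrier n → Motion
    translation v = record
      { move      = λ x i → x i + v i
      ; move-cong = λ x≋y i → +-congʳ (x≋y i)
      ; move-dist = λ x y → B-cong (cancel-v x y) (cancel-v x y)
      }
      where
      cancel-v : ∀ x y → (λ i → x i + v i) ⊝ (λ i → y i + v i) ≋ x ⊝ y
      cancel-v x y i = solve 3 (λ x y v → (x :+ v) :- (y :+ v) := x :- y) refl (x i) (y i) (v i)

    -- The function dist z b - dist z a of z is affine and vanishes on the perpendicular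
    -- bisector of a and b, so ρ is the reflection in it.
    module Bisector (a b : Vector Carrier n) (b≉a : dist b a ≉ 0#) where
      κ : Carrier
      κ = proj₁ (invertible b≉a)

      κ-inverse : κ * dist b a ≈ 1#
      κ-inverse = proj₁ (proj₂ (invertible b≉a))

      scale : Vector Carrier n → Carrier
      scale z = κ * (dist z b - dist z a)

      ρ : Vector Carrier n → Vector Carrier n
      ρ z = z ⊕ scale z · (b ⊝ a)

      scale-cong : ∀ {x y} → x ≋ y → scale x ≈ scale y
      scale-cong x≋y = *-congˡ (+-cong (dist-cong x≋y (λ _ → refl))
        (-‿cong (dist-cong x≋y (λ _ → refl))))

      -- In `dist z b - dist z a` the terms `B z z` cancel, leaving an affine function of `z` whose
      -- constant part drops out of the difference. Hence `ρ` acts on differences as the linear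
      -- reflection with normal `b ⊝ a`.
      scale-difference : ∀ x y → scale x - scale y ≈ - (⌜ 2 ⌝ * (κ * B (x ⊝ y) (b ⊝ a)))
      scale-difference x y = begin
        scale x - scale y
          ≈⟨ +-cong (scale-expand x) (-‿cong (scale-expand y)) ⟩
        κ * (⌜ 2 ⌝ * (B x a - B x b) + (B b b - B a a)) -
        κ * (⌜ 2 ⌝ * (B y a - B y b) + (B b b - B a a))
          ≈⟨ solve 6 (λ κ xa xb ya yb d →
               κ :* (‵ 2 :* (xa :- xb) :+ d) :- κ :* (‵ 2 :* (ya :- yb) :+ d) :=
               :- (‵ 2 :* (κ :* ((xb :- xa) :- (yb :- ya))))) refl κ _ _ _ _ _ ⟩
        - (⌜ 2 ⌝ * (κ * ((B x b - B x a) - (B y b - B y a))))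
          ≈⟨ -‿cong (*-congˡ (*-congˡ (trans (B-⊝ˡ x y (b ⊝ a))
               (+-cong (B-⊝ʳ b a x) (-‿cong (B-⊝ʳ b a y)))))) ⟨
        - (⌜ 2 ⌝ * (κ * B (x ⊝ y) (b ⊝ a))) ∎
        where
        scale-expand : ∀ z → scale z ≈ κ * (⌜ 2 ⌝ * (B z a - B z b) + (B b b - B a a))
        scale-expand z = *-congˡ (trans (+-cong (dist-expand z b) (-‿cong (dist-expand z a)))
          (solve 5 (λ zz za zb aa bb → (zz :- ‵ 2 :* zb :+ bb) :- (zz :- ‵ 2 :* za :+ aa) :=
             ‵ 2 :* (za :- zb) :+ (bb :- aa)) refl _ _ _ _ _))

      ρ-dist : ∀ x y → dist (ρ x) (ρ y) ≈ dist x y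
      ρ-dist x y = begin
        dist (ρ x) (ρ y)
          ≈⟨ B-cong regroup regroup ⟩
        B (δ ⊕ m · v) (δ ⊕ m · v)
          ≈⟨ B-⊕-⊕ δ m v ⟩
        B δ δ + ⌜ 2 ⌝ * (m * B δ v) + m * m * B v v
          -- As `m = -2κβ` and `κ d = 1`, the term `m²d` becomes `-2mβ` and cancels `2mβ`.
          ≈⟨ solve 5 (λ q m β d κ → q :+ ‵ 2 :* (m :* β) :+ m :* m :* d :- q :=
               (m :* d) :* (m :- (:- (‵ 2 :* (κ :* β)))) :+
               (:- (‵ 2 :* (β :* m))) :* (κ :* d :- ‵ 1)) refl (B δ δ) m (B δ v) (B v v) κ
             by _ ·[ scale-difference x y ] & _ ·[ κ-inverse ] ⟩
        dist x y ∎
        where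
        δ = x ⊝ y
        v = b ⊝ a
        m = scale x - scale y

        regroup : ρ x ⊝ ρ y ≋ δ ⊕ m · v
        regroup i = solve 5 (λ x y l k v → (x :+ l :* v) :- (y :+ k :* v) :=
          (x :- y) :+ (l :- k) :* v) refl (x i) (y i) (scale x) (scale y) (v i)

      motion : Motion
      motion = record
        { move      = ρ
        ; move-cong = λ x≋y i → +-cong (x≋y i) (*-congʳ (scale-cong x≋y))
        ; move-dist = ρ-dist
        }

      ρ-a : ρ a ≋ b
      ρ-a i = trans (+-congˡ (*-congʳ scale-a))
        (solve 2 (λ a b → a :+ ‵ 1 :* (b :- a) := b) refl (a i) (b i))
        where
        scale-a : scale a ≈ 1#
        scale-a = begin
          κ * (dist a b - dist a a)
            ≈⟨ *-congˡ (+-cong (dist-sym a b) (-‿cong (dist-self {a} {a} (λ _ → refl)))) ⟩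
          κ * (dist b a - 0#)
            ≈⟨ *-congˡ (solve 1 (λ d → d :- ‵ 0 := d) refl _) ⟩
          κ * dist b a
            ≈⟨ κ-inverse ⟩
          1# ∎

      ρ-fixes : ∀ z → dist z a ≈ dist z b → ρ z ≋ z
      ρ-fixes z za≈zb i = solve 5 (λ z κ p q v →
        z :+ κ :* (q :- p) :* v :- z := (:- (κ :* v)) :* (p :- q))
        refl (z i) κ (dist z a) (dist z b) ((b ⊝ a) i) by _ ·[ za≈zb ]

  *-cancelˡ-≉0 : ∀ {x a b} → x ≉ 0# → x * a ≈ x * b → a ≈ b
  *-cancelˡ-≉0 {x} {a} {b} x≉0 xa≈xb = solve 4 (λ x y a b →
    a :- b := y :* (x :* a :- x :* b) :- (a :- b) :* (y :* x :- ‵ 1)) refl x y a b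
    by trans (+-congˡ (-‿cong (_ ·[ y*x≈1 ]))) (trans (+-congʳ (_ ·[ xa≈xb ])) (-‿inverseʳ 0#))
    where
    y     = proj₁ (invertible x≉0)
    y*x≈1 = proj₁ (proj₂ (invertible x≉0))

  -- Unit vectors, their partial sums and the dot product.

  unit : ∀ {n} → Fin n → Vector Carrier n
  unit zero    zero    = 1#
  unit zero    (suc j) = 0#
  unit (suc i) zero    = 0#
  unit (suc i) (suc j) = unit i j

  unit-same : ∀ {n} (i : Fin n) → unit i i ≈ 1#
  unit-same zero    = refl
  unit-same (suc i) = unit-same i

  unit-different : ∀ {n} (i j : Fin n) → i ≢ j → unit i j ≈ 0#
  unit-different zero    zero    i≢j = ⊥-elim (i≢j ≡.refl)
  unit-different zero    (suc j) i≢j = refl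
  unit-different (suc i) zero    i≢j = refl
  unit-different (suc i) (suc j) i≢j = unit-different i j (λ i≡j → i≢j (≡.cong suc i≡j))

  -- The sum of the first `k` unit vectors, or of all of them if `k` exceeds `n`.
  initial : ∀ {n} → ℕ → Vector Carrier n
  initial ℕ.zero    j       = 0#
  initial (ℕ.suc k) zero    = 1#
  initial (ℕ.suc k) (suc j) = initial k j

  initial-< : ∀ {n} k (j : Fin n) → toℕ j ℕ.< k → initial k j ≈ 1#
  initial-< (ℕ.suc k) zero    _           = refl
  initial-< (ℕ.suc k) (suc j) (ℕ.s≤s j<k) = initial-< k j j<k

  initial-≥ : ∀ {n} k (j : Fin n) → k ℕ.≤ toℕ j → initial k j ≈ 0#
  initial-≥ ℕ.zero    j       _           = refl
  initial-≥ (ℕ.suc k) (suc j) (ℕ.s≤s k≤j) = initial-≥ k j k≤j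

  -- The factor `1#` makes this by definition the form `B` for the weights `replicate n 1#`, hence
  -- also the part of `B` after the first coordinate when the weights are `⌜ 2 ⌝ ∷ replicate n 1#`.
  dot : ∀ {n} → Vector Carrier n → Vector Carrier n → Carrier
  dot x y = sum (λ i → 1# * (x i * y i))

  dot-0 : ∀ {n} (x : Vector Carrier n) → dot x (λ _ → 0#) ≈ 0#
  dot-0 {ℕ.zero}  x = refl
  dot-0 {ℕ.suc n} x = trans
    (+-cong (solve 1 (λ a → ‵ 1 :* (a :* ‵ 0) := ‵ 0) refl (x zero)) (dot-0 (tail x)))
    (+-identityˡ 0#)

  dot-unit : ∀ {n} (x : Vector Carrier n) i → dot x (unit i) ≈ x i
  dot-unit x zero    = trans (+-congˡ (dot-0 (tail x)))
    (solve 1 (λ a → ‵ 1 :* (a :* ‵ 1) :+ ‵ 0 := a) refl (x zero))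
  dot-unit x (suc i) = trans (+-congˡ (dot-unit (tail x) i))
    (solve 2 (λ a b → ‵ 1 :* (a :* ‵ 0) :+ b := b) refl (x zero) (x (suc i)))

  dot-initial : ∀ {n} {k} → k ℕ.≤ n → (x : Vector Carrier n) → ∀ {t} →
    (∀ j → toℕ j ℕ.< k → x j ≈ t) → dot x (initial k) ≈ ⌜ k ⌝ * t
  dot-initial {k = ℕ.zero}  _           x x≈t = trans (dot-0 x) (sym (zeroˡ _))
  dot-initial {k = ℕ.suc k} (ℕ.s≤s k≤n) x {t} x≈t = begin
    1# * (x zero * 1#) + dot (tail x) (initial k)
      ≈⟨ +-cong (*-congˡ (*-congʳ (x≈t zero (ℕ.s≤s ℕ.z≤n))))
           (dot-initial k≤n (tail x) (λ j j<k → x≈t (suc j) (ℕ.s≤s j<k))) ⟩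
    1# * (t * 1#) + ⌜ k ⌝ * t
      ≈⟨ solve 2 (λ t k → ‵ 1 :* (t :* ‵ 1) :+ k :* t := (‵ 1 :+ k) :* t) refl t ⌜ k ⌝ ⟩
    ⌜ ℕ.suc k ⌝ * t ∎

  dot-constant : ∀ {n} (x y : Vector Carrier n) {a b} →
    (∀ i → x i ≈ a) → (∀ i → y i ≈ b) → dot x y ≈ ⌜ n ⌝ * (a * b)
  dot-constant {n} x y {a} {b} x≈a y≈b = begin
    dot x y                        ≈⟨ sum-cong-≋ (λ i → *-congˡ (*-cong (x≈a i) (y≈b i))) ⟩
    sum (replicate n (1# * (a * b)))  ≈⟨ sum-replicate n ⟩
    n ×ₙ (1# * (a * b))            ≈⟨ ×-assoc-* n 1# (a * b) ⟨
    ⌜ n ⌝ * (a * b)                ∎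

  -- The standard simplex in ⟨2⟩ ⊥ N⟨1⟩.

  module Simplex (char0 : CharacteristicZero) (N : ℕ) where
    V : Set c
    V = Vector Carrier (ℕ.suc N)

    open DiagonalForm (⌜ 2 ⌝ ∷ replicate N 1#)
    open Motion

    2≉0 : ⌜ 2 ⌝ ≉ 0#
    2≉0 = char0 1

    e : Fin N → V
    e i = 0# ∷ unit i

    B-e : ∀ x i → B x (e i) ≈ x (suc i)
    B-e x i = trans (+-congˡ (dot-unit (tail x) i))
      (solve 2 (λ a b → ‵ 2 :* (a :* ‵ 0) :+ b := b) refl (x zero) (x (suc i)))

    B-e-e : ∀ i → B (e i) (e i) ≈ 1#
    B-e-e i = trans (B-e (e i) i) (unit-same i)

    dist-e : ∀ x i → dist x (e i) ≈ B x x - ⌜ 2 ⌝ * x (suc i) + 1#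
    dist-e x i = trans (dist-expand x (e i))
      (+-cong (+-congˡ (-‿cong (*-congˡ (B-e x i)))) (B-e-e i))

    dist-e-e : ∀ i j → i ≢ j → dist (e i) (e j) ≈ ⌜ 2 ⌝
    dist-e-e i j i≢j = begin
      dist (e i) (e j)
        ≈⟨ dist-e (e i) j ⟩
      B (e i) (e i) - ⌜ 2 ⌝ * e i (suc j) + 1#
        ≈⟨ +-congʳ (+-cong (B-e-e i) (-‿cong (*-congˡ (unit-different i j i≢j)))) ⟩
      1# - ⌜ 2 ⌝ * 0# + 1#
        ≈⟨ solve 0 (‵ 1 :- ‵ 2 :* ‵ 0 :+ ‵ 1 := ‵ 2) refl ⟩
      ⌜ 2 ⌝ ∎

    -- The right-hand side is the same for all `i`: a point at distance 2 from several `e i` has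
    -- equal coordinates along them.
    coordinate : ∀ x i → dist x (e i) ≈ ⌜ 2 ⌝ → ⌜ 2 ⌝ * x (suc i) ≈ B x x - 1#
    coordinate x i xe≈2 = solve 2 (λ q x → ‵ 2 :* x :- (q :- ‵ 1) :=
      (:- ‵ 1) :* (q :- ‵ 2 :* x :+ ‵ 1 :- ‵ 2)) refl (B x x) (x (suc i))
      by _ ·[ trans (sym (dist-e x i)) xe≈2 ]

    -- Witt extension, one point at a time.

    record Moves (i₀ : Fin N) (f : V) : Set (c ⊔ ℓ) where
      field
        motion : Motion
        sends  : move motion f ≋ e i₀
        fixes  : ∀ i → toℕ i ℕ.< toℕ i₀ → move motion (e i) ≋ e i

    -- The index is a successor, so at least one point is already in place, and the number `K` of
    -- such points is invertible in characteristic 0.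
    module Step (i₀ : Fin N) (k : ℕ) (i₀≡k : toℕ i₀ ≡ ℕ.suc k) (f : V)
      (f-equidistant : ∀ i → toℕ i ℕ.< toℕ i₀ → dist f (e i) ≈ ⌜ 2 ⌝) where

      K : Carrier
      K = ⌜ ℕ.suc k ⌝

      κ : Carrier
      κ = proj₁ (invertible (char0 k))

      κK≈1 : κ * K ≈ 1#
      κK≈1 = proj₁ (proj₂ (invertible (char0 k)))

      g : V
      g = e i₀

      sum-e : V
      sum-e = 0# ∷ initial (ℕ.suc k)

      k<N : ℕ.suc k ℕ.≤ N
      k<N = ≡.subst (ℕ._≤ N) i₀≡k (ℕₚ.<⇒≤ (Finₚ.toℕ<n i₀))

      below : ∀ {i : Fin N} → toℕ i ℕ.< ℕ.suc k → toℕ i ℕ.< toℕ i₀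
      below {i} = ≡.subst (toℕ i ℕ.<_) (≡.sym i₀≡k)

      below⁻¹ : ∀ {i : Fin N} → toℕ i ℕ.< toℕ i₀ → toℕ i ℕ.< ℕ.suc k
      below⁻¹ {i} = ≡.subst (toℕ i ℕ.<_) i₀≡k

      B-sum-e : ∀ x {t} → (∀ i → toℕ i ℕ.< ℕ.suc k → x (suc i) ≈ t) → B x sum-e ≈ K * t
      B-sum-e x {t} x≈t = trans (+-congˡ (dot-initial k<N (tail x) x≈t))
        (solve 2 (λ a b → ‵ 2 :* (a :* ‵ 0) :+ b := b) refl (x zero) (K * t))

      -- The reflection of g in the centroid of the e i below i₀, with normal v.
      v : V
      v = sum-e ⊕ - K · g

      g′ : V
      g′ = g ⊕ ⌜ 2 ⌝ * κ · v

      sum-e-i₀ : B sum-e g ≈ 0#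
      sum-e-i₀ = trans (B-e sum-e i₀) (initial-≥ (ℕ.suc k) i₀ (ℕₚ.≤-reflexive (≡.sym i₀≡k)))

      B-v : ∀ x {t} → (∀ i → toℕ i ℕ.< ℕ.suc k → x (suc i) ≈ t) → B x v ≈ K * t - K * x (suc i₀)
      B-v x {t} x≈t = begin
        B x v                        ≈⟨ B-⊕ʳ sum-e (- K) g x ⟩
        B x sum-e + - K * B x g      ≈⟨ +-cong (B-sum-e x x≈t) (*-congˡ (B-e x i₀)) ⟩
        K * t + - K * x (suc i₀)     ≈⟨ +-congˡ (-‿distribˡ-* K (x (suc i₀))) ⟨
        K * t - K * x (suc i₀)       ∎

      B-g-v : B g v ≈ - K
      B-g-v = begin
        B g v                    ≈⟨ B-v g (λ i i<k → unit-different i₀ i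
                                      (λ { ≡.refl → ℕₚ.<-irrefl ≡.refl (below {i} i<k) })) ⟩
        K * 0# - K * g (suc i₀)  ≈⟨ +-congˡ (-‿cong (*-congˡ (unit-same i₀))) ⟩
        K * 0# - K * 1#          ≈⟨ solve 1 (λ k → k :* ‵ 0 :- k :* ‵ 1 := :- k) refl K ⟩
        - K                      ∎

      B-v-v : B v v ≈ K + K * K
      B-v-v = begin
        B v v
          ≈⟨ B-⊕ˡ sum-e (- K) g v ⟩
        B sum-e v + - K * B g v
          ≈⟨ +-cong (B-v sum-e (λ i i<k → initial-< (ℕ.suc k) i i<k)) (*-congˡ B-g-v) ⟩
        K * 1# - K * sum-e (suc i₀) + - K * - K
          ≈⟨ +-congʳ (+-congˡ (-‿cong (*-congˡ (trans (sym (B-e sum-e i₀)) sum-e-i₀)))) ⟩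
        K * 1# - K * 0# + - K * - K
          ≈⟨ solve 1 (λ k → k :* ‵ 1 :- k :* ‵ 0 :+ (:- k) :* (:- k) := k :+ k :* k) refl K ⟩
        K + K * K ∎

      B-g′-g′ : B g′ g′ ≈ 1# + ⌜ 4 ⌝ * κ
      B-g′-g′ = begin
        B g′ g′
          ≈⟨ B-⊕-⊕ g (⌜ 2 ⌝ * κ) v ⟩
        B g g + ⌜ 2 ⌝ * (⌜ 2 ⌝ * κ * B g v) + ⌜ 2 ⌝ * κ * (⌜ 2 ⌝ * κ) * B v v
          ≈⟨ +-cong (+-cong (B-e-e i₀) (*-congˡ (*-congˡ B-g-v))) (*-congˡ B-v-v) ⟩
        1# + ⌜ 2 ⌝ * (⌜ 2 ⌝ * κ * - K) + ⌜ 2 ⌝ * κ * (⌜ 2 ⌝ * κ) * (K + K * K)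
          ≈⟨ solve 2 (λ κ k →
               ‵ 1 :+ ‵ 2 :* (‵ 2 :* κ :* (:- k)) :+ ‵ 2 :* κ :* (‵ 2 :* κ) :* (k :+ k :* k) :-
               (‵ 1 :+ ‵ 4 :* κ) := (‵ 4 :* κ :+ ‵ 4 :* κ :* k) :* (κ :* k :- ‵ 1)) refl κ K
             by _ ·[ κK≈1 ] ⟩
        1# + ⌜ 4 ⌝ * κ ∎

      -- This is the value of `dist g g′`. Multiplied by `K` it becomes the integer
      -- `4K + 4 = 4(k + 2)`.
      4+4κ≉0 : ⌜ 4 ⌝ + ⌜ 4 ⌝ * κ ≉ 0#
      4+4κ≉0 4+4κ≈0 = char0 (ℕ.suc k ℕ.+ 3 ℕ.* ℕ.2+ k) (trans (×1-homo-* 4 (ℕ.2+ k))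
        (solve 2 (λ κ k → ‵ 4 :* (‵ 1 :+ k) :- ‵ 0 :=
            k :* (‵ 4 :+ ‵ 4 :* κ :- ‵ 0) :+ (:- ‵ 4) :* (κ :* k :- ‵ 1)) refl κ K
         by _ ·[ 4+4κ≈0 ] & _ ·[ κK≈1 ]))

      g′-g : dist g g′ ≉ 0#
      g′-g gg′≈0 = 4+4κ≉0 (begin
        ⌜ 4 ⌝ + ⌜ 4 ⌝ * κ
          ≈⟨ solve 2 (λ κ k →
               ‵ 4 :+ ‵ 4 :* κ :- (‵ 1 :- ‵ 2 :* (‵ 1 :+ ‵ 2 :* κ :* (:- k)) :+ (‵ 1 :+ ‵ 4 :* κ)) :=
               (:- ‵ 4) :* (κ :* k :- ‵ 1)) refl κ K by _ ·[ κK≈1 ] ⟩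
        1# - ⌜ 2 ⌝ * (1# + ⌜ 2 ⌝ * κ * - K) + (1# + ⌜ 4 ⌝ * κ)
          ≈⟨ +-cong (+-cong (B-e-e i₀) (-‿cong (*-congˡ (trans (B-⊕ʳ g (⌜ 2 ⌝ * κ) v g)
               (+-cong (B-e-e i₀) (*-congˡ B-g-v)))))) B-g′-g′ ⟨
        B g g - ⌜ 2 ⌝ * B g g′ + B g′ g′
          ≈⟨ dist-expand g g′ ⟨
        dist g g′
          ≈⟨ gg′≈0 ⟩
        0# ∎)

      e-g : ∀ i → toℕ i ℕ.< toℕ i₀ → dist (e i) g ≈ ⌜ 2 ⌝
      e-g i i<i₀ = dist-e-e i i₀ (λ { ≡.refl → ℕₚ.<-irrefl ≡.refl i<i₀ })

      e-f : ∀ i → toℕ i ℕ.< toℕ i₀ → dist (e i) f ≈ ⌜ 2 ⌝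
      e-f i i<i₀ = trans (dist-sym (e i) f) (f-equidistant i i<i₀)

      e-g′ : ∀ i → toℕ i ℕ.< toℕ i₀ → dist (e i) g′ ≈ ⌜ 2 ⌝
      e-g′ i i<i₀ = begin
        dist (e i) g′
          ≈⟨ dist-expand (e i) g′ ⟩
        B (e i) (e i) - ⌜ 2 ⌝ * B (e i) g′ + B g′ g′
          ≈⟨ +-cong (+-cong (B-e-e i) (-‿cong (*-congˡ B-e-g′))) B-g′-g′ ⟩
        1# - ⌜ 2 ⌝ * (⌜ 2 ⌝ * κ) + (1# + ⌜ 4 ⌝ * κ)
          ≈⟨ solve 1 (λ κ → ‵ 1 :- ‵ 2 :* (‵ 2 :* κ) :+ (‵ 1 :+ ‵ 4 :* κ) := ‵ 2) refl κ ⟩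
        ⌜ 2 ⌝ ∎
        where
        i≢i₀ : i ≢ i₀
        i≢i₀ ≡.refl = ℕₚ.<-irrefl ≡.refl i<i₀

        B-e-g : B (e i) g ≈ 0#
        B-e-g = trans (B-e (e i) i₀) (unit-different i i₀ i≢i₀)

        B-e-sum : B (e i) sum-e ≈ 1#
        B-e-sum = trans (B-comm (e i) sum-e) 
          (trans (B-e sum-e i) (initial-< (ℕ.suc k) i (below⁻¹ i<i₀)))

        B-e-g′ : B (e i) g′ ≈ ⌜ 2 ⌝ * κ
        B-e-g′ = begin
          B (e i) g′
            ≈⟨ B-⊕ʳ g (⌜ 2 ⌝ * κ) v (e i) ⟩
          B (e i) g + ⌜ 2 ⌝ * κ * B (e i) v
            ≈⟨ +-cong B-e-g (*-congˡ (trans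
                 (B-⊕ʳ sum-e (- K) g (e i)) (+-cong B-e-sum (*-congˡ B-e-g)))) ⟩
          0# + ⌜ 2 ⌝ * κ * (1# + - K * 0#)
            ≈⟨ solve 2 (λ κ k → ‵ 0 :+ ‵ 2 :* κ :* (‵ 1 :+ (:- k) :* ‵ 0) := ‵ 2 :* κ) refl κ K ⟩
          ⌜ 2 ⌝ * κ ∎

      f-coordinate : ∀ i → toℕ i ℕ.< toℕ i₀ → ⌜ 2 ⌝ * f (suc i) ≈ B f f - 1#
      f-coordinate i i<i₀ = coordinate f i (f-equidistant i i<i₀)

      -- The centroid is the midpoint of `g` and `g′` and its distance from `f` is `1 + κ`, so by
      -- the parallelogram law `dist g f + dist g′ f = 2(1 + κ) + (4 + 4κ) / 2 = 4 + 4κ`. The two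
      -- distances cannot both vanish.
      f-g′ : dist g f ≈ 0# → dist g′ f ≉ 0#
      f-g′ gf≈0 g′f≈0 = 4+4κ≉0 (begin
        ⌜ 4 ⌝ + ⌜ 4 ⌝ * κ
          ≈⟨ solve 5 (λ κ k t x q →
               ‵ 4 :+ ‵ 4 :* κ :-
               ((‵ 1 :+ ‵ 4 :* κ) :- ‵ 2 :* (x :+ ‵ 2 :* κ :* (k :* t :- k :* x)) :+ q) :=
               (‵ 4 :* (t :- x)) :* (κ :* k :- ‵ 1) :+
               (‵ 2 :* (‵ 2 :* t :- (q :- ‵ 1)) :+
               ‵ 1 :* (q :- ‵ 2 :* x :+ ‵ 1 :- ‵ 0))) refl κ K t (f (suc i₀)) (B f f)
             by _ ·[ κK≈1 ] & _ ·[ f-coordinate i₁ i₁<i₀ ]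
              & _ ·[ trans (sym (dist-e f i₀)) (trans (dist-sym f g) gf≈0) ] ⟩
        (1# + ⌜ 4 ⌝ * κ) - ⌜ 2 ⌝ * (f (suc i₀) + ⌜ 2 ⌝ * κ * (K * t - K * f (suc i₀))) + B f f
          ≈⟨ +-congʳ (+-cong B-g′-g′ (-‿cong (*-congˡ B-g′-f))) ⟨
        B g′ g′ - ⌜ 2 ⌝ * B g′ f + B f f
          ≈⟨ dist-expand g′ f ⟨
        dist g′ f
          ≈⟨ g′f≈0 ⟩
        0# ∎)
        where
        -- This is index 0, which lies below `i₀`; the coordinate of `f` there serves as the common
        -- value `t`.
        i₁ : Fin N
        i₁ = Fin.fromℕ< (ℕₚ.≤-trans (ℕ.s≤s ℕ.z≤n) k<N)

        i₁<i₀ : toℕ i₁ ℕ.< toℕ i₀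
        i₁<i₀ = below {i₁} (≡.subst (ℕ._< ℕ.suc k) (≡.sym (Finₚ.toℕ-fromℕ< _)) (ℕ.s≤s ℕ.z≤n))

        t : Carrier
        t = f (suc i₁)

        f≈t : ∀ i → toℕ i ℕ.< ℕ.suc k → f (suc i) ≈ t
        f≈t i i<k = *-cancelˡ-≉0 2≉0
          (trans (f-coordinate i (below {i} i<k)) (sym (f-coordinate i₁ i₁<i₀)))

        B-g′-f : B g′ f ≈ f (suc i₀) + ⌜ 2 ⌝ * κ * (K * t - K * f (suc i₀))
        B-g′-f = trans (B-comm g′ f) (trans (B-⊕ʳ g (⌜ 2 ⌝ * κ) v f)
          (+-cong (B-e f i₀) (*-congˡ (B-v f f≈t))))

      -- If `dist g f` is nonzero, a single reflection takes `f` to `g`, and its mirror contains the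
      -- earlier `e i` because they are equidistant from both. If it vanishes, that reflection is
      -- undefined and the route goes through `g′`, which is at distance 2 from the same `e i`.
      -- Vanishing is not decidable, so the case split yields a double negation.
      moves : ¬ ¬ Moves i₀ f
      moves ¬moves = ¬¬-excluded-middle λ where
        (no g-f) → let open Bisector f g g-f in ¬moves record
          { motion = motion
          ; sends  = ρ-a
          ; fixes  = λ i i<i₀ → ρ-fixes (e i) (trans (e-f i i<i₀) (sym (e-g i i<i₀)))
          }
        (yes gf≈0) →
          let module R₁ = Bisector f g′ (f-g′ gf≈0)
              module R₂ = Bisector g′ g g′-g
          in ¬moves record
          { motion = R₁.motion ⨟ R₂.motion
          ; sends  = λ i → trans (move-cong R₂.motion R₁.ρ-a i) (R₂.ρ-a i)
          ; fixes  = λ i i<i₀ j → trans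
              (move-cong R₂.motion (R₁.ρ-fixes (e i) (trans (e-f i i<i₀) (sym (e-g′ i i<i₀)))) j)
              (R₂.ρ-fixes (e i) (trans (e-g′ i i<i₀) (sym (e-g i i<i₀))) j)
          }

    translate : ∀ (i₀ : Fin N) → toℕ i₀ ≡ 0 → ∀ f → Moves i₀ f
    translate i₀ i₀≡0 f = record
      { motion = translation (e i₀ ⊝ f)
      ; sends  = λ j → solve 2 (λ f g → f :+ (g :- f) := g) refl (f j) (e i₀ j)
      ; fixes  = λ i i<i₀ → ⊥-elim (ℕₚ.n≮0 (≡.subst (toℕ i ℕ.<_) i₀≡0 i<i₀))
      }

    moves : ∀ i₀ f → (∀ i → toℕ i ℕ.< toℕ i₀ → dist f (e i) ≈ ⌜ 2 ⌝) → ¬ ¬ Moves i₀ f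
    moves i₀ f f-equidistant ¬moves with toℕ i₀ in i₀≡
    ... | ℕ.zero  = ¬moves (translate i₀ i₀≡ f)
    ... | ℕ.suc k = Step.moves i₀ k i₀≡ f
      (λ i i<i₀ → f-equidistant i (≡.subst (toℕ i ℕ.<_) i₀≡ i<i₀)) ¬moves

    -- Bringing an equidistant set into standard position.

    IsEquidistant : ∀ {k} → Vector V k → Set ℓ
    IsEquidistant y = ∀ i j → i ≢ j → dist (y i) (y j) ≈ ⌜ 2 ⌝

    Equidistant : ℕ → Set (c ⊔ ℓ)
    Equidistant k = ∃[ y ] IsEquidistant {k} y

    -- The first `N` points are to become the simplex, those with index below `k` already have; the
    -- last `r` are carried along.
    record StandardBelow (k r : ℕ) : Set (c ⊔ ℓ) where
      field
        points      : Vector V (N ℕ.+ r)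
        equidistant : IsEquidistant points
        standard    : ∀ i → toℕ i ℕ.< k → points (i ↑ˡ r) ≋ e i

    advance : ∀ {k r} → k ℕ.< N → StandardBelow k r → ¬ ¬ StandardBelow (ℕ.suc k) r
    advance {k} {r} k<N S ¬next = moves i₀ f f-equidistant λ m → ¬next (next m)
      where
      open StandardBelow S

      i₀ : Fin N
      i₀ = Fin.fromℕ< k<N

      i₀≡k : toℕ i₀ ≡ k
      i₀≡k = Finₚ.toℕ-fromℕ< k<N

      f : V
      f = points (i₀ ↑ˡ r)

      f-equidistant : ∀ i → toℕ i ℕ.< toℕ i₀ → dist f (e i) ≈ ⌜ 2 ⌝
      f-equidistant i i<i₀ = trans
        (dist-cong {f} (λ _ → refl) (λ j → sym (standard i (≡.subst (toℕ i ℕ.<_) i₀≡k i<i₀) j)))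
        (equidistant (i₀ ↑ˡ r) (i ↑ˡ r) (λ eq →
          ℕₚ.<-irrefl (≡.cong toℕ (≡.sym (Finₚ.↑ˡ-injective r i₀ i eq))) i<i₀))

      next : Moves i₀ f → StandardBelow (ℕ.suc k) r
      next m = record
        -- The motion is applied to the whole set, so that all mutual distances survive.
        { points      = move motion ∘ points
        ; equidistant = λ i j i≢j → trans (move-dist motion _ _) (equidistant i j i≢j)
        ; standard    = λ i i<1+k → case ℕₚ.m≤n⇒m<n∨m≡n (ℕ.s≤s⁻¹ i<1+k) of λ where
            (inj₁ i<k) j → trans (move-cong motion (standard i i<k) j)
              (fixes i (≡.subst (toℕ i ℕ.<_) (≡.sym i₀≡k) i<k) j)
            (inj₂ i≡k) → ≡.subst (λ i → move motion (points (i ↑ˡ r)) ≋ e i)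
              (Finₚ.toℕ-injective (≡.trans i₀≡k (≡.sym i≡k))) sends
        }
        where open Moves m

    standardise : ∀ {r} k → k ℕ.≤ N → Equidistant (N ℕ.+ r) → ¬ ¬ StandardBelow k r
    standardise ℕ.zero    k≤N (y , y-equidistant) ¬S =
      ¬S record { points = y ; equidistant = y-equidistant ; standard = λ _ () }
    standardise (ℕ.suc k) k<N E ¬S =
      standardise k (ℕₚ.<⇒≤ k<N) E λ S → advance k<N S ¬S

    -- Reduction to Gram matrices in the plane ⟨1, 2N⟩.

    K : Carrier
    K = ⌜ N ⌝

    -- The bilinear form of ⟨1, 2N⟩.
    β : Carrier × Carrier → Carrier × Carrier → Carrier
    β (x , t) (x′ , t′) = x * x′ + ⌜ 2 ⌝ * K * (t * t′)

    -- The Gram matrix is `N I + J`, where `J` is the all-ones matrix.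
    record Planar (r : ℕ) : Set (c ⊔ ℓ) where
      field
        points : Vector (Carrier × Carrier) r
        norm   : ∀ j → β (points j) (points j) ≈ ⌜ ℕ.suc N ⌝
        cross  : ∀ j l → j ≢ l → β (points j) (points l) ≈ 1#

    -- A point with constant coordinates a along the simplex and t along its axis is
    -- encoded as (N a - 1, t).
    B-constant : ∀ {x y : V} {a b} → (∀ i → x (suc i) ≈ a) → (∀ i → y (suc i) ≈ b) →
      β (K * a - 1# , x zero) (K * b - 1# , y zero) ≈ 1# + K * (B x y - (a + b))
    B-constant {x} {y} {a} {b} x≈a y≈b = trans
      (solve 5 (λ k a b s t → (k :* a :- ‵ 1) :* (k :* b :- ‵ 1) :+ ‵ 2 :* k :* (s :* t) :=
         ‵ 1 :+ k :* (‵ 2 :* (s :* t) :+ k :* (a :* b) :- (a :+ b))) refl K a b (x zero) (y zero))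
      (+-congˡ (*-congˡ (+-congʳ (+-congˡ (sym (dot-constant (tail x) (tail y) x≈a y≈b))))))

    -- Distance 2 from every `e i` forces a constant coordinate `a` with `2a = B p p - 1`. The
    -- formula of `B-constant` then gives the norm `1 + K`, and `B-cross` makes its last term vanish
    -- for two different points.
    standard⇒planar : ∀ {r} → StandardBelow N r → Planar r
    standard⇒planar {r} S = record
      { points = λ j → K * a j - 1# , p j zero
      ; norm   = λ j → begin
          β (K * a j - 1# , p j zero) (K * a j - 1# , p j zero)
            ≈⟨ B-constant {p j} {p j} (p≈a j) (p≈a j) ⟩
          1# + K * (B (p j) (p j) - (a j + a j))
            ≈⟨ solve 3 (λ k q a → ‵ 1 :+ k :* (q :- (a :+ a)) :- (‵ 1 :+ k) :=
                 (:- k) :* (‵ 2 :* a :- (q :- ‵ 1))) refl K (B (p j) (p j)) (a j) by _ ·[ 2a j ] ⟩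
          ⌜ ℕ.suc N ⌝ ∎
      ; cross  = λ j l j≢l → begin
          β (K * a j - 1# , p j zero) (K * a l - 1# , p l zero)
            ≈⟨ B-constant {p j} {p l} (p≈a j) (p≈a l) ⟩
          1# + K * (B (p j) (p l) - (a j + a l))
            ≈⟨ +-congˡ (*-congˡ (x≈y⇒x∙y⁻¹≈ε (B-cross j l j≢l))) ⟩
          1# + K * 0#
            ≈⟨ solve 1 (λ k → ‵ 1 :+ k :* ‵ 0 := ‵ 1) refl K ⟩
          1# ∎
      }
      where
      open StandardBelow S

      p : Fin r → V
      p j = points (N ↑ʳ j)

      ½ : Carrier
      ½ = proj₁ (invertible 2≉0)

      a : Fin r → Carrier
      a j = ½ * (B (p j) (p j) - 1#)

      2a : ∀ j → ⌜ 2 ⌝ * a j ≈ B (p j) (p j) - 1#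
      2a j = solve 2 (λ h q → ‵ 2 :* (h :* q) :- q := q :* (h :* ‵ 2 :- ‵ 1)) refl ½ _
        by _ ·[ proj₁ (proj₂ (invertible 2≉0)) ]

      p≈a : ∀ j i → p j (suc i) ≈ a j
      p≈a j i = *-cancelˡ-≉0 2≉0 (trans (coordinate (p j) i p-e) (sym (2a j)))
        where
        p-e : dist (p j) (e i) ≈ ⌜ 2 ⌝
        p-e = trans (dist-cong {p j} (λ _ → refl) (λ l → sym (standard i (Finₚ.toℕ<n i) l)))
          (equidistant (N ↑ʳ j) (i ↑ˡ r) (↑ʳ≢↑ˡ i j))

      -- Substituting `B p p = 1 + 2a` at both points, distance 2 reads
      -- `2 + 2(a + a′) - 2 B p p′ = 2`.
      B-cross : ∀ j l → j ≢ l → B (p j) (p l) ≈ a j + a l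
      B-cross j l j≢l = *-cancelˡ-≉0 2≉0
        (solve 5 (λ q b q′ a a′ → ‵ 2 :* b :- ‵ 2 :* (a :+ a′) :=
          (:- ‵ 1) :* (q :- ‵ 2 :* b :+ q′ :- ‵ 2) :+
          ((:- ‵ 1) :* (‵ 2 :* a :- (q :- ‵ 1)) :+ (:- ‵ 1) :* (‵ 2 :* a′ :- (q′ :- ‵ 1))))
          refl (B (p j) (p j)) (B (p j) (p l)) (B (p l) (p l)) (a j) (a l)
         by _ ·[ trans (sym (dist-expand (p j) (p l)))
                   (equidistant (N ↑ʳ j) (N ↑ʳ l) (j≢l ∘ Finₚ.↑ʳ-injective N j l)) ]
          & _ ·[ 2a j ] & _ ·[ 2a l ])

    equidistant⇒planar : ∀ {r} → Equidistant (N ℕ.+ r) → ¬ ¬ Planar r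
    equidistant⇒planar E ¬P = standardise N ℕₚ.≤-refl E (¬P ∘ standard⇒planar)

    -- The encoding is inverted: a first entry `x` gives back `a = (x + 1) / N`, which uses that `N`
    -- is invertible. The conditions on `β` become `B p p = 1 + 2a` and `B p p′ = a + a′`, that is,
    -- distance 2 from the simplex and from each other.
    planar⇒equidistant : ∀ {r} → K ≉ 0# → Planar r → Equidistant (N ℕ.+ r)
    planar⇒equidistant {r} K≉0 P = y ∘ Fin.splitAt N , λ i j i≢j →
      y-equidistant (Fin.splitAt N i) (Fin.splitAt N j) (i≢j ∘ splitAt-injective i j)
      where
      open Planar P

      splitAt-injective : ∀ i j → Fin.splitAt N {r} i ≡ Fin.splitAt N j → i ≡ j
      splitAt-injective i j eq = ≡.trans (≡.sym (Finₚ.join-splitAt N r i))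
        (≡.trans (≡.cong (Fin.join N r) eq) (Finₚ.join-splitAt N r j))

      ν : Carrier
      ν = proj₁ (invertible K≉0)

      a : Fin r → Carrier
      a j = ν * (proj₁ (points j) + 1#)

      X≈Ka-1 : ∀ j → proj₁ (points j) ≈ K * a j - 1#
      X≈Ka-1 j = solve 3 (λ k v x → x :- (k :* (v :* (x :+ ‵ 1)) :- ‵ 1) :=
        (:- (x :+ ‵ 1)) :* (v :* k :- ‵ 1)) refl K ν (proj₁ (points j))
        by _ ·[ proj₁ (proj₂ (invertible K≉0)) ]

      p : Fin r → V
      p j = proj₂ (points j) ∷ replicate N (a j)

      β-points : ∀ j l → β (points j) (points l) ≈ 1# + K * (B (p j) (p l) - (a j + a l))
      β-points j l = trans (+-congʳ (*-cong (X≈Ka-1 j) (X≈Ka-1 l)))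
        (B-constant {p j} {p l} (λ _ → refl) (λ _ → refl))

      B-norm : ∀ j → B (p j) (p j) ≈ 1# + ⌜ 2 ⌝ * a j
      B-norm j = *-cancelˡ-≉0 K≉0 (solve 3 (λ k q a → k :* q :- k :* (‵ 1 :+ ‵ 2 :* a) :=
        ‵ 1 :* (‵ 1 :+ k :* (q :- (a :+ a)) :- (‵ 1 :+ k))) refl K (B (p j) (p j)) (a j)
        by _ ·[ trans (sym (β-points j j)) (norm j) ])

      B-cross : ∀ j l → j ≢ l → B (p j) (p l) ≈ a j + a l
      B-cross j l j≢l = *-cancelˡ-≉0 K≉0 (solve 3 (λ k q a → k :* q :- k :* a :=
        ‵ 1 :* (‵ 1 :+ k :* (q :- a) :- ‵ 1)) refl K (B (p j) (p l)) (a j + a l)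
        by _ ·[ trans (sym (β-points j l)) (cross j l j≢l) ])

      y : Fin N ⊎ Fin r → V
      y = [ e , p ]′

      p-e : ∀ j i → dist (p j) (e i) ≈ ⌜ 2 ⌝
      p-e j i = trans (dist-e (p j) i) (solve 2 (λ q a → q :- ‵ 2 :* a :+ ‵ 1 :- ‵ 2 :=
        ‵ 1 :* (q :- (‵ 1 :+ ‵ 2 :* a))) refl (B (p j) (p j)) (a j) by _ ·[ B-norm j ])

      y-equidistant : ∀ u v → u ≢ v → dist (y u) (y v) ≈ ⌜ 2 ⌝
      y-equidistant (inj₁ i) (inj₁ j) u≢v = dist-e-e i j (u≢v ∘ ≡.cong inj₁)
      y-equidistant (inj₁ i) (inj₂ j) u≢v = trans (dist-sym (e i) (p j)) (p-e j i)
      y-equidistant (inj₂ j) (inj₁ i) u≢v = p-e j i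
      y-equidistant (inj₂ j) (inj₂ l) u≢v = begin
        dist (p j) (p l)
          ≈⟨ dist-expand (p j) (p l) ⟩
        B (p j) (p j) - ⌜ 2 ⌝ * B (p j) (p l) + B (p l) (p l)
          ≈⟨ +-cong
               (+-cong (B-norm j) (-‿cong (*-congˡ (B-cross j l (u≢v ∘ ≡.cong inj₂))))) (B-norm l) ⟩
        1# + ⌜ 2 ⌝ * a j - ⌜ 2 ⌝ * (a j + a l) + (1# + ⌜ 2 ⌝ * a l)
          ≈⟨ solve 2 (λ a b →
               ‵ 1 :+ ‵ 2 :* a :- ‵ 2 :* (a :+ b) :+ (‵ 1 :+ ‵ 2 :* b) := ‵ 2) refl (a j) (a l) ⟩
        ⌜ 2 ⌝ ∎

    -- Systems of up to three vectors in the plane.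

    planar₀ : Planar 0
    planar₀ = record { points = λ () ; norm = λ () ; cross = λ () }

    planar₁ : ∀ P → β P P ≈ ⌜ ℕ.suc N ⌝ → Planar 1
    planar₁ P PP≈n = record
      { points = λ _ → P
      ; norm   = λ _ → PP≈n
      ; cross  = λ { zero zero 0≢0 → ⊥-elim (0≢0 ≡.refl) }
      }

    form-value : ∀ x t → 1# * (x * x) + (⌜ 2 ℕ.* N ⌝ * (t * t) + 0#) ≈ β (x , t) (x , t)
    form-value x t = +-cong (*-identityˡ _) (trans (+-identityʳ _) (*-congʳ (×1-homo-* 2 N)))

    β⇒D : ∀ P → β P P ≈ ⌜ ℕ.suc N ⌝ → D ⟪1, ⌜ 2 ℕ.* N ⌝ ⟫ ⌜ ℕ.suc N ⌝
    β⇒D (x , t) PP≈n = char0 N , x ∷ t ∷ [] , trans (form-value x t) PP≈n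

    D⇒β : D ⟪1, ⌜ 2 ℕ.* N ⌝ ⟫ ⌜ ℕ.suc N ⌝ → ∃[ P ] β P P ≈ ⌜ ℕ.suc N ⌝
    D⇒β (_ , x , x≈n) = (x zero , x (suc zero)) , trans (sym (form-value _ _)) x≈n

    2[n+1] : ⌜ 2 ℕ.* (ℕ.suc N ℕ.+ 1) ⌝ ≈ ⌜ 2 ⌝ * (⌜ ℕ.suc N ⌝ + 1#)
    2[n+1] = trans (×1-homo-* 2 (ℕ.suc N ℕ.+ 1))
      (*-congˡ (trans (×-homo-+ 1# (ℕ.suc N) 1) (+-congˡ (+-identityʳ 1#))))

    -- The Gram determinant `n² - 1 = N(n + 1)` is the discriminant `2N` times `δ²`, where `δ` is
    -- the determinant of the coordinates. Doubling and cancelling `N` gives `2(n + 1) = (2δ)²`.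
    planar₂⇒square : K ≉ 0# → Planar 2 → F*² ⌜ 2 ℕ.* (ℕ.suc N ℕ.+ 1) ⌝
    -- The argument of `char0` is the predecessor of `2(n + 1)` in unfolded form.
    planar₂⇒square K≉0 P = char0 (N ℕ.+ 1 ℕ.+ (ℕ.suc N ℕ.+ 1 ℕ.+ 0)) , ⌜ 2 ⌝ * δ ,
      trans 2[n+1] (*-cancelˡ-≉0 K≉0 (begin
        K * (⌜ 2 ⌝ * (⌜ ℕ.suc N ⌝ + 1#))
          ≈⟨ solve 1 (λ k → k :* (‵ 2 :* (‵ 1 :+ k :+ ‵ 1)) :=
               ‵ 2 :* ((‵ 1 :+ k) :* (‵ 1 :+ k) :- ‵ 1 :* ‵ 1)) refl K ⟩
        ⌜ 2 ⌝ * (⌜ ℕ.suc N ⌝ * ⌜ ℕ.suc N ⌝ - 1# * 1#)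
          ≈⟨ *-congˡ (+-cong (*-cong (norm zero) (norm (suc zero))) (-‿cong (*-cong P₀P₁ P₀P₁))) ⟨
        ⌜ 2 ⌝ * (β P₀ P₀ * β P₁ P₁ - β P₀ P₁ * β P₀ P₁)
          ≈⟨ solve 5 (λ k x t y u →
               ‵ 2 :* ((x :* x :+ ‵ 2 :* k :* (t :* t)) :* (y :* y :+ ‵ 2 :* k :* (u :* u)) :-
                 (x :* y :+ ‵ 2 :* k :* (t :* u)) :* (x :* y :+ ‵ 2 :* k :* (t :* u))) :=
               k :* (‵ 2 :* (x :* u :- y :* t) :* (‵ 2 :* (x :* u :- y :* t))))
               refl K (proj₁ P₀) (proj₂ P₀) (proj₁ P₁) (proj₂ P₁) ⟩
        K * (⌜ 2 ⌝ * δ * (⌜ 2 ⌝ * δ)) ∎))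
      where
      open Planar P
      P₀ = points zero
      P₁ = points (suc zero)
      δ = proj₁ P₀ * proj₂ P₁ - proj₁ P₁ * proj₂ P₀

      P₀P₁ : β P₀ P₁ ≈ 1#
      P₀P₁ = cross zero (suc zero) (λ ())

    -- The Gram determinant of three vectors of a plane vanishes.
    ¬planar₃ : K ≉ 0# → ¬ Planar 3
    ¬planar₃ K≉0 P = char0 (2 ℕ.+ N)
      (trans 3+K≈ (*-cancelˡ-≉0 K≉0 (*-cancelˡ-≉0 K≉0 (trans K²[3+K]≈0 (sym K²0≈0)))))
      where
      open Planar P
      P₀ = points zero
      P₁ = points (suc zero)
      P₂ = points (suc (suc zero))
      n = ⌜ ℕ.suc N ⌝

      3+K≈ : ⌜ 3 ℕ.+ N ⌝ ≈ ⌜ 3 ⌝ + K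
      3+K≈ = ×-homo-+ 1# 3 N

      K²0≈0 : K * (K * 0#) ≈ 0#
      K²0≈0 = solve 1 (λ k → k :* (k :* ‵ 0) := ‵ 0) refl K

      P₀P₁ : β P₀ P₁ ≈ 1#
      P₀P₁ = cross zero (suc zero) (λ ())

      P₀P₂ : β P₀ P₂ ≈ 1#
      P₀P₂ = cross zero (suc (suc zero)) (λ ())

      P₁P₂ : β P₁ P₂ ≈ 1#
      P₁P₂ = cross (suc zero) (suc (suc zero)) (λ ())

      -- The left side is the determinant of `N I + J` of order 3, expanded along the first row.
      -- Once the entries are written in two coordinates it is identically zero as a polynomial.
      K²[3+K]≈0 : K * (K * (⌜ 3 ⌝ + K)) ≈ 0#
      K²[3+K]≈0 = begin
        K * (K * (⌜ 3 ⌝ + K))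
          ≈⟨ solve 1 (λ k → k :* (k :* (‵ 3 :+ k)) :=
               (‵ 1 :+ k) :* ((‵ 1 :+ k) :* (‵ 1 :+ k) :- ‵ 1 :* ‵ 1) :-
               ‵ 1 :* (‵ 1 :* (‵ 1 :+ k) :- ‵ 1 :* ‵ 1) :+
               ‵ 1 :* (‵ 1 :* ‵ 1 :- (‵ 1 :+ k) :* ‵ 1)) refl K ⟩
        n * (n * n - 1# * 1#) - 1# * (1# * n - 1# * 1#) + 1# * (1# * 1# - n * 1#)
          ≈⟨ +-cong (+-cong
               (*-cong (norm zero) (+-cong
                 (*-cong (norm (suc zero)) (norm (suc (suc zero)))) (-‿cong (*-cong P₁P₂ P₁P₂))))
               (-‿cong (*-cong P₀P₁ (+-cong
                 (*-cong P₀P₁ (norm (suc (suc zero)))) (-‿cong (*-cong P₁P₂ P₀P₂))))))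
               (*-cong P₀P₂ (+-cong (*-cong P₀P₁ P₁P₂) (-‿cong (*-cong (norm (suc zero)) P₀P₂)))) ⟨
        β P₀ P₀ * (β P₁ P₁ * β P₂ P₂ - β P₁ P₂ * β P₁ P₂) -
        β P₀ P₁ * (β P₀ P₁ * β P₂ P₂ - β P₁ P₂ * β P₀ P₂) +
        β P₀ P₂ * (β P₀ P₁ * β P₁ P₂ - β P₁ P₁ * β P₀ P₂)
          ≈⟨ solve 7 (λ l x t y u z v →
               let b₀₀ = x :* x :+ l :* (t :* t)
                   b₀₁ = x :* y :+ l :* (t :* u)
                   b₀₂ = x :* z :+ l :* (t :* v)
                   b₁₁ = y :* y :+ l :* (u :* u)
                   b₁₂ = y :* z :+ l :* (u :* v)
                   b₂₂ = z :* z :+ l :* (v :* v)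
               in b₀₀ :* (b₁₁ :* b₂₂ :- b₁₂ :* b₁₂) :- b₀₁ :* (b₀₁ :* b₂₂ :- b₁₂ :* b₀₂) :+
                  b₀₂ :* (b₀₁ :* b₁₂ :- b₁₁ :* b₀₂) := ‵ 0)
               refl (⌜ 2 ⌝ * K) (proj₁ P₀) (proj₂ P₀) (proj₁ P₁) (proj₂ P₁) (proj₁ P₂) (proj₂ P₂) ⟩
        0# ∎

    -- The second vector is P / n + b (-2Nt , x), where b = z / (2n) and z² = 2(n + 1).
    planar₂ : ∀ P → β P P ≈ ⌜ ℕ.suc N ⌝ → F*² ⌜ 2 ℕ.* (ℕ.suc N ℕ.+ 1) ⌝ → Planar 2
    planar₂ P@(x , t) PP≈n (_ , z , z²) = record
      { points = P ∷ P′ ∷ []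
      ; norm   = λ { zero → PP≈n ; (suc zero) → P′P′ }
      ; cross  = λ where
          zero       zero       0≢0 → ⊥-elim (0≢0 ≡.refl)
          zero       (suc zero) _   → PP′
          (suc zero) zero       _   → trans P′P PP′
          (suc zero) (suc zero) 1≢1 → ⊥-elim (1≢1 ≡.refl)
      }
      where
      n = ⌜ ℕ.suc N ⌝

      ½ : Carrier
      ½ = proj₁ (invertible 2≉0)

      η : Carrier
      η = proj₁ (invertible (char0 N))

      ηn≈1 : η * n ≈ 1#
      ηn≈1 = proj₁ (proj₂ (invertible (char0 N)))

      b : Carrier
      b = ½ * (z * η)

      P′ : Carrier × Carrier
      P′ = η * x - b * (⌜ 2 ⌝ * K * t) , η * t + b * x

      PP′ : β P P′ ≈ 1#
      PP′ = begin
        β P P′      ≈⟨ solve 5 (λ x t η b l →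
                         x :* (η :* x :- b :* (l :* t)) :+ l :* (t :* (η :* t :+ b :* x)) :=
                         η :* (x :* x :+ l :* (t :* t))) refl x t η b (⌜ 2 ⌝ * K) ⟩
        η * β P P   ≈⟨ *-congˡ PP≈n ⟩
        η * n       ≈⟨ ηn≈1 ⟩
        1#          ∎

      P′P : β P′ P ≈ β P P′
      P′P = +-cong (*-comm _ _) (*-congˡ (*-comm _ _))

      2b² : ⌜ 2 ⌝ * (b * b) ≈ (n + 1#) * (η * η)
      2b² = *-cancelˡ-≉0 2≉0 (begin
        ⌜ 2 ⌝ * (⌜ 2 ⌝ * (b * b))
          ≈⟨ solve 3 (λ h z η →
               ‵ 2 :* (‵ 2 :* ((h :* (z :* η)) :* (h :* (z :* η)))) :- z :* z :* (η :* η) :=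
               (z :* z :* (η :* η) :* (h :* ‵ 2 :+ ‵ 1)) :* (h :* ‵ 2 :- ‵ 1)) refl ½ z η
             by _ ·[ proj₁ (proj₂ (invertible 2≉0)) ] ⟩
        z * z * (η * η)
          ≈⟨ *-congʳ (trans (sym z²) 2[n+1]) ⟩
        ⌜ 2 ⌝ * (n + 1#) * (η * η)
          ≈⟨ *-assoc _ _ _ ⟩
        ⌜ 2 ⌝ * ((n + 1#) * (η * η)) ∎)

      -- The vector `(-2Nt , x)` is orthogonal to `P` and has `2N` times its norm, so `P′` has norm
      -- `(η² + 2N b²) n = η² (1 + N(n + 1)) n`, where `1 + N(n + 1) = n²` because `N = n - 1`.
      P′P′ : β P′ P′ ≈ n
      P′P′ = begin
        β P′ P′
          ≈⟨ solve 5 (λ x t η b k →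
               (η :* x :- b :* (‵ 2 :* k :* t)) :* (η :* x :- b :* (‵ 2 :* k :* t)) :+
               ‵ 2 :* k :* ((η :* t :+ b :* x) :* (η :* t :+ b :* x)) :=
               (η :* η :+ k :* (‵ 2 :* (b :* b))) :* (x :* x :+ ‵ 2 :* k :* (t :* t))) refl x t η b K ⟩
        (η * η + K * (⌜ 2 ⌝ * (b * b))) * β P P
          ≈⟨ *-cong (+-congˡ (*-congˡ 2b²)) PP≈n ⟩
        (η * η + K * ((n + 1#) * (η * η))) * n
          ≈⟨ solve 2 (λ η k → let n = ‵ 1 :+ k in
               (η :* η :+ k :* ((n :+ ‵ 1) :* (η :* η))) :* n :- n :=
               (n :* (η :* n :+ ‵ 1)) :* (η :* n :- ‵ 1)) refl η K
             by _ ·[ ηn≈1 ] ⟩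
        n ∎

  -- A similitude of the sum of an even number of squares.

  module _ (h : Carrier) where
    twist : ∀ m → Vector Carrier (m ℕ.* 2) → Vector Carrier (m ℕ.* 2)
    twist ℕ.zero    x             = x
    twist (ℕ.suc m) x zero          = h * (x zero + x (suc zero))
    twist (ℕ.suc m) x (suc zero)    = h * (x zero - x (suc zero))
    twist (ℕ.suc m) x (suc (suc i)) = twist m (tail (tail x)) i

    twist-⊝ : ∀ m x y → twist m (x ⊝ y) ≋ twist m x ⊝ twist m y
    twist-⊝ (ℕ.suc m) x y zero = solve 5 (λ h a b c d →
      h :* ((a :- b) :+ (c :- d)) := h :* (a :+ c) :- h :* (b :+ d)) refl
      h (x zero) (y zero) (x (suc zero)) (y (suc zero))
    twist-⊝ (ℕ.suc m) x y (suc zero) = solve 5 (λ h a b c d →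
      h :* ((a :- b) :- (c :- d)) := h :* (a :- c) :- h :* (b :- d)) refl
      h (x zero) (y zero) (x (suc zero)) (y (suc zero))
    twist-⊝ (ℕ.suc m) x y (suc (suc i)) = twist-⊝ m (tail (tail x)) (tail (tail y)) i

    -- Each pair contributes `(a + b)² + (a - b)² = 2(a² + b²)`, scaled by `h²`. Thus `h = 1`
    -- doubles the sum of squares and `h = 1/2` halves it.
    dot-twist : ∀ m x → dot (twist m x) (twist m x) ≈ ⌜ 2 ⌝ * (h * h) * dot x x
    dot-twist ℕ.zero    x = sym (zeroʳ _)
    dot-twist (ℕ.suc m) x = trans (+-congˡ (+-congˡ (dot-twist m (tail (tail x)))))
      (solve 4 (λ h a b d →
        ‵ 1 :* (h :* (a :+ b) :* (h :* (a :+ b))) :+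
        (‵ 1 :* (h :* (a :- b) :* (h :* (a :- b))) :+ ‵ 2 :* (h :* h) :* d) :=
        ‵ 2 :* (h :* h) :* (‵ 1 :* (a :* a) :+ (‵ 1 :* (b :* b) :+ d))) refl
        h (x zero) (x (suc zero)) (dot (tail (tail x)) (tail (tail x))))

  -- Cliques as equidistant sets.

  module OddSquares (char0 : CharacteristicZero) (m : ℕ) where
    N n : ℕ
    N = m ℕ.* 2
    n = ℕ.suc N

    open Simplex char0 N
    open DiagonalForm (⌜ 2 ⌝ ∷ replicate N 1#) using (dist; B-cong)

    G = 𝒢 (s n) 1#

    ½ : Carrier
    ½ = proj₁ (invertible 2≉0)

    ½*2≈1 : ½ * ⌜ 2 ⌝ ≈ 1#
    ½*2≈1 = proj₁ (proj₂ (invertible 2≉0))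

    -- `ψ` halves distances: at the first coordinate the weight drops from 2 to 1, and on the even
    -- number of remaining coordinates `twist ½` halves the sum of squares.
    toClique : ∀ {k} → Equidistant k → HasClique G k
    toClique (y , equidistant) = (λ i → ψ (y i)) , λ {i} {j} i≢j →
      let dist≈1 = ψ-dist (y i) (y j) (equidistant i j i≢j)
      -- Adjacency also asks for unequal vertices; equal ones would be at distance 0 instead of 1.
      in (λ ψ≋ → 0≉1 (trans (sym (Dot.dist-self ψ≋)) dist≈1)) , dist≈1
      where
      module Dot = DiagonalForm (replicate n 1#)

      ψ : V → Vector Carrier n
      ψ x = x zero ∷ twist ½ m (tail x)

      ψ-⊝ : ∀ x y → ψ x ⊝ ψ y ≋ ψ (x ⊝ y)
      ψ-⊝ x y zero    = refl
      ψ-⊝ x y (suc i) = sym (twist-⊝ ½ m (tail x) (tail y) i)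

      ψ-dist : ∀ x y → dist x y ≈ ⌜ 2 ⌝ → Dot.dist (ψ x) (ψ y) ≈ 1#
      ψ-dist x y xy≈2 = *-cancelˡ-≉0 2≉0 (begin
        ⌜ 2 ⌝ * Dot.dist (ψ x) (ψ y)
          ≈⟨ *-congˡ (Dot.B-cong (ψ-⊝ x y) (ψ-⊝ x y)) ⟩
        ⌜ 2 ⌝ * (1# * (z zero * z zero) + dot (twist ½ m (tail z)) (twist ½ m (tail z)))
          ≈⟨ *-congˡ (+-congˡ (dot-twist ½ m (tail z))) ⟩
        ⌜ 2 ⌝ * (1# * (z zero * z zero) + ⌜ 2 ⌝ * (½ * ½) * dot (tail z) (tail z))
          ≈⟨ solve 3 (λ h a d → ‵ 2 :* (‵ 1 :* (a :* a) :+ ‵ 2 :* (h :* h) :* d) :-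
               (‵ 2 :* (a :* a) :+ d) := (d :* (h :* ‵ 2 :+ ‵ 1)) :* (h :* ‵ 2 :- ‵ 1))
               refl ½ (z zero) (dot (tail z) (tail z)) by _ ·[ ½*2≈1 ] ⟩
        dist x y
          ≈⟨ xy≈2 ⟩
        ⌜ 2 ⌝
          ≈⟨ *-identityʳ _ ⟨
        ⌜ 2 ⌝ * 1# ∎)
        where z = x ⊝ y

    -- In the opposite direction `φ` doubles distances, with weight 2 at the first coordinate and
    -- `h = 1` on the rest.
    fromClique : ∀ {k} → HasClique G k → Equidistant k
    fromClique (x , clique) = (λ i → φ (x i)) , λ i j i≢j → φ-dist (x i) (x j) (proj₂ (clique i≢j))
      where
      φ : Vector Carrier n → V
      φ x = x zero ∷ twist 1# m (tail x)

      φ-⊝ : ∀ x y → φ x ⊝ φ y ≋ φ (x ⊝ y)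
      φ-⊝ x y zero    = refl
      φ-⊝ x y (suc i) = sym (twist-⊝ 1# m (tail x) (tail y) i)

      φ-dist : ∀ x y → dot (x ⊝ y) (x ⊝ y) ≈ 1# → dist (φ x) (φ y) ≈ ⌜ 2 ⌝
      φ-dist x y xy≈1 = begin
        dist (φ x) (φ y)
          ≈⟨ B-cong (φ-⊝ x y) (φ-⊝ x y) ⟩
        ⌜ 2 ⌝ * (z zero * z zero) + dot (twist 1# m (tail z)) (twist 1# m (tail z))
          ≈⟨ +-congˡ (dot-twist 1# m (tail z)) ⟩
        ⌜ 2 ⌝ * (z zero * z zero) + ⌜ 2 ⌝ * (1# * 1#) * dot (tail z) (tail z)
          ≈⟨ solve 2 (λ a d → ‵ 2 :* (a :* a) :+ ‵ 2 :* (‵ 1 :* ‵ 1) :* d :=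
               ‵ 2 :* (‵ 1 :* (a :* a) :+ d)) refl (z zero) (dot (tail z) (tail z)) ⟩
        ⌜ 2 ⌝ * dot z z
          ≈⟨ *-congˡ xy≈1 ⟩
        ⌜ 2 ⌝ * 1#
          ≈⟨ *-identityʳ _ ⟩
        ⌜ 2 ⌝ ∎
        where z = x ⊝ y

    subclique : ∀ {k l} → k ℕ.≤ l → HasClique G l → HasClique G k
    subclique k≤l (x , clique) = (λ i → x (Fin.inject≤ i k≤l)) , λ i≢j →
      clique (i≢j ∘ Finₚ.inject≤-injective k≤l k≤l _ _)

    -- Any larger clique contains one of size `k + 1`, so excluding this one size is enough.
    cliqueNumber : ∀ {k} → HasClique G k → ¬ HasClique G (ℕ.suc k) → CliqueNumber G k
    cliqueNumber clique ¬clique =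
      clique , λ l clique-l → ℕₚ.≮⇒≥ (λ k<l → ¬clique (subclique k<l clique-l))

    -- The three cases when `N` is nonzero.

    module _ (K≉0 : K ≉ 0#) where
      clique : ∀ r k → k ≡ N ℕ.+ r → Planar r → HasClique G k
      clique r k ≡.refl P = toClique (planar⇒equidistant K≉0 P)

      -- The conclusion is a negation and so absorbs the double negation left by the reflections.
      ¬clique : ∀ r k → k ≡ N ℕ.+ r → ¬ Planar r → ¬ HasClique G k
      ¬clique r k ≡.refl ¬P C = equidistant⇒planar (fromClique C) ¬P

      D⇒planar₁ : D ⟪1, ⌜ 2 ℕ.* N ⌝ ⟫ ⌜ n ⌝ → Planar 1
      D⇒planar₁ d = planar₁ (proj₁ (D⇒β d)) (proj₂ (D⇒β d))

      ω≡n-1 : ¬ D ⟪1, ⌜ 2 ℕ.* N ⌝ ⟫ ⌜ n ⌝ → CliqueNumber G N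
      ω≡n-1 ¬d = cliqueNumber (clique 0 N (≡.sym (ℕₚ.+-identityʳ N)) planar₀)
        (¬clique 1 n (ℕₚ.+-comm 1 N) λ P →
          ¬d (β⇒D (Planar.points P zero) (Planar.norm P zero)))

      ω≡n : D ⟪1, ⌜ 2 ℕ.* N ⌝ ⟫ ⌜ n ⌝ → ¬ F*² ⌜ 2 ℕ.* (n ℕ.+ 1) ⌝ → CliqueNumber G n
      ω≡n d ¬sq = cliqueNumber (clique 1 n (ℕₚ.+-comm 1 N) (D⇒planar₁ d))
        (¬clique 2 (ℕ.suc n) (ℕₚ.+-comm 2 N) (¬sq ∘ planar₂⇒square K≉0))

      ω≡n+1 : D ⟪1, ⌜ 2 ℕ.* N ⌝ ⟫ ⌜ n ⌝ → F*² ⌜ 2 ℕ.* (n ℕ.+ 1) ⌝ → CliqueNumber G (n ℕ.+ 1)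
      ω≡n+1 d sq = cliqueNumber
        (clique 2 (n ℕ.+ 1) (≡.sym (ℕₚ.+-suc N 1)) (planar₂ (proj₁ (D⇒β d)) (proj₂ (D⇒β d)) sq))
        (¬clique 3 (ℕ.suc (n ℕ.+ 1))
          (≡.trans (≡.cong ℕ.suc (≡.sym (ℕₚ.+-suc N 1))) (≡.sym (ℕₚ.+-suc N 2)))
          (¬planar₃ K≉0))

  -- The case `n = 1`.

  module Line (char0 : CharacteristicZero) where
    open OddSquares char0 0
    open Simplex char0 0

    represents : D ⟪1, ⌜ 0 ⌝ ⟫ ⌜ 1 ⌝
    represents = β⇒D (1# , 0#)
      (solve 0 (‵ 1 :* ‵ 1 :+ ‵ 2 :* ‵ 0 :* (‵ 0 :* ‵ 0) := ‵ 1 :+ ‵ 0) refl)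

    square : F*² ⌜ 4 ⌝
    square = char0 3 , ⌜ 2 ⌝ , ×1-homo-* 2 2

    two-points : Equidistant 2
    two-points = (λ { zero → 0# ∷ [] ; (suc zero) → 1# ∷ [] }) , λ where
      zero       zero       0≢0 → ⊥-elim (0≢0 ≡.refl)
      zero       (suc zero) _   → solve 0
        (‵ 2 :* ((‵ 0 :- ‵ 1) :* (‵ 0 :- ‵ 1)) :+ ‵ 0 := ‵ 2) refl
      (suc zero) zero       _   → solve 0
        (‵ 2 :* ((‵ 1 :- ‵ 0) :* (‵ 1 :- ‵ 0)) :+ ‵ 0 := ‵ 2) refl
      (suc zero) (suc zero) 1≢1 → ⊥-elim (1≢1 ≡.refl)

    -- Consecutive differences `u` and `v` satisfy `u² = v² = (u + v)² = 1`. Hence `2uv = -1`, and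
    -- squaring gives `4 = 4u²v² = 1`, that is, `3 = 0`.
    ¬three-points : ¬ Equidistant 3
    ¬three-points (y , equidistant) = char0 2
      (solve 2 (λ u v → ‵ 3 :- ‵ 0 :=
        (:- ‵ 4 :* v :* v :- (‵ 2 :* u :* v :- ‵ 1)) :* (u :* u :- ‵ 1) :+
        ((:- ‵ 4 :- (‵ 2 :* u :* v :- ‵ 1)) :* (v :* v :- ‵ 1) :+
        (‵ 2 :* u :* v :- ‵ 1) :* ((u :+ v) :* (u :+ v) :- ‵ 1))) refl u v
       by _ ·[ unit-distance zero (suc zero) (λ ()) ]
        & _ ·[ unit-distance (suc zero) (suc (suc zero)) (λ ()) ]
        & _ ·[ trans (*-cong u+v u+v) (unit-distance zero (suc (suc zero)) (λ ())) ])
      where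
      t : Fin 3 → Carrier
      t i = y i zero

      u = t zero - t (suc zero)
      v = t (suc zero) - t (suc (suc zero))

      u+v : u + v ≈ t zero - t (suc (suc zero))
      u+v = solve 3 (λ x y z → (x :- y) :+ (y :- z) := x :- z) refl _ _ _

      unit-distance : ∀ i j → i ≢ j → (t i - t j) * (t i - t j) ≈ 1#
      unit-distance i j i≢j = *-cancelˡ-≉0 2≉0
        (trans (sym (+-identityʳ _)) (trans (equidistant i j i≢j) (sym (*-identityʳ _))))

    ω≡2 : CliqueNumber G 2
    ω≡2 = cliqueNumber (toClique two-points) (¬three-points ∘ fromClique)

-- Parity and the final case distinction.

odd⇒1+m*2 : ∀ n → 2 ∤ n → ∃[ m ] n ≡ ℕ.suc (m ℕ.* 2)
odd⇒1+m*2 n 2∤n with n % 2 in n%2 | m%n<n n 2 | m≡m%n+[m/n]*n n 2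
... | 0      | _                | _  = ⊥-elim (2∤n (m%n≡0⇒n∣m n 2 n%2))
... | 1      | _                | eq = n / 2 , eq
... | ℕ.2+ _ | ℕ.s≤s (ℕ.s≤s ()) | _

open import Data.Nat.Base using (_+_; _*_; _∸_)

theorem5p5 : ∀ {c ℓ} (F : Field c ℓ) → let open OverField F in let open Field F using (1#) in
    CharacteristicZero → (n : ℕ) → 2 ∤ n →
    (¬ D ⟪1, ⌜ 2 * (n ∸ 1) ⌝ ⟫ ⌜ n ⌝ →
    CliqueNumber (𝒢 (s n) 1#) (n ∸ 1)) ×
    (D ⟪1, ⌜ 2 * (n ∸ 1) ⌝ ⟫ ⌜ n ⌝ → ¬ F*² ⌜ 2 * (n + 1) ⌝ →
    CliqueNumber (𝒢 (s n) 1#) n) ×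
    (D ⟪1, ⌜ 2 * (n ∸ 1) ⌝ ⟫ ⌜ n ⌝ → F*² ⌜ 2 * (n + 1) ⌝ →
    CliqueNumber (𝒢 (s n) 1#) (n + 1))
theorem5p5 F char0 n 2∤n with odd⇒1+m*2 n 2∤n
... | ℕ.zero  , ≡.refl =
  -- For `n = 1` the form ⟨1, 0⟩ represents 1 and `2(n + 1) = 4` is a square, so only the third case
  -- can occur.
  (λ ¬d → ⊥-elim (¬d represents)) , (λ _ ¬sq → ⊥-elim (¬sq square)) , (λ _ _ → ω≡2)
  where
  open OverAField F
  open Line char0
... | ℕ.suc m , ≡.refl = ω≡n-1 K≉0 , ω≡n K≉0 , ω≡n+1 K≉0
  where
  open OverAField F
  open OddSquares char0 (ℕ.suc m)
  K≉0 = char0 (ℕ.suc (m ℕ.* 2))
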